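{- Let $a,c\in\mathbb{Z}$ with $c\neq 0$ and let $k,m,n\in\mathbb{N}$ with $km>n\ge 1$. Suppose $f(x)=(x^k+c)^m-ax^n\in\mathbb{Z}[x]$ is irreducible over $\mathbb{Q}$. Let $t=\gcd(n,k)$, $n=n_1t$, $k=k_1t$. Then $$\mathfrak{D}_f=(-1)^{\binom{km}{2}+(km+n+t)(m-1)}\,a^{k(m-1)}\,c^{m(n-1)}\left[(km)^{k_1m}c^{k_1m-n_1}-a^{k_1}n^{n_1}(km-n)^{k_1m-n_1}\right]^{t}.$$
   Context: $\mathfrak{D}_f$ denotes the discriminant of the monic polynomial $f(x)$ (degree $km$). The convention $0^0=1$ is used. -}

module Defs where

open import Algebra.Bundles.Raw using (RawRing; RawSemiring)
import Algebra.Definitions.RawSemiring as RawSemiringDefs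
open import Data.Bool.Base using (if_then_else_)
open import Data.Fin.Base using (Fin; zero; suc; toℕ; opposite; punchIn; splitAt)
open import Data.Integer.Base as ℤ using (ℤ; 0ℤ; 1ℤ; -1ℤ)
open import Data.Integer.Properties as ℤ using ()
open import Data.List.Base using (List; []; _∷_; map; replicate; _++_)
open import Data.List.Relation.Unary.All using (all?)
open import Data.Nat.Base as ℕ using (ℕ; zero; suc)
open import Data.Nat.Combinatorics using (_C_)
open import Data.Rational.Base as ℚ using (ℚ)
open import Data.Sum.Base using ([_,_]′)
open import Relation.Nullary.Decidable using (does)

-- Univariate polynomials over R as coefficient lists, constant term first.
-- Trailing zeros are allowed, so the equality of polynomials is _≈ᴾ_, not _≡_.
module Polynomial {a ℓ} (R : RawRing a ℓ) where
  open RawRing R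

  Poly : Set a
  Poly = List Carrier

  coeff : Poly → ℕ → Carrier
  coeff []      _       = 0#
  coeff (x ∷ p) zero    = x
  coeff (x ∷ p) (suc i) = coeff p i

  infix 4 _≈ᴾ_
  _≈ᴾ_ : Poly → Poly → Set ℓ
  p ≈ᴾ q = ∀ i → coeff p i ≈ coeff q i

  const : Carrier → Poly
  const x = x ∷ []

  X : Poly
  X = 0# ∷ 1# ∷ []

  infixl 6 _+ᴾ_ _-ᴾ_
  infixl 7 _*ᴾ_

  _+ᴾ_ : Poly → Poly → Poly
  []      +ᴾ q       = q
  (x ∷ p) +ᴾ []      = x ∷ p
  (x ∷ p) +ᴾ (y ∷ q) = (x + y) ∷ (p +ᴾ q)

  _-ᴾ_ : Poly → Poly → Poly
  p -ᴾ q = p +ᴾ map -_ q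

  _*ᴾ_ : Poly → Poly → Poly
  []      *ᴾ q = []
  (x ∷ p) *ᴾ q = map (x *_) q +ᴾ (0# ∷ (p *ᴾ q))

  polyRawSemiring : RawSemiring a ℓ
  polyRawSemiring = record
    { Carrier = Poly ; _≈_ = _≈ᴾ_ ; _+_ = _+ᴾ_ ; _*_ = _*ᴾ_
    ; 0# = [] ; 1# = const 1# }

  open RawSemiringDefs polyRawSemiring public
    using (Irreducible) renaming (_^_ to _^ᴾ_)

  -- The Leibniz rule: (x + X p)′ = p + X p′.
  derivative : Poly → Poly
  derivative []      = []
  derivative (x ∷ p) = p +ᴾ (0# ∷ derivative p)

  -- X ^ s * p
  shift : ℕ → Poly → Poly
  shift s p = replicate s 0# ++ p

  -- Sylvester matrix of p and q, of degrees d and e:  the rows are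
  -- X^(e-1) p , … , X p , p , X^(d-1) q , … , X q , q  and the columns hold the
  -- coefficients of X^(e+d-1) , … , X , 1.
  sylvester : (d e : ℕ) → Poly → Poly →
              Fin (e ℕ.+ d) → Fin (e ℕ.+ d) → Carrier
  sylvester d e p q i j = coeff (row i) (toℕ (opposite j))
    where
    row : Fin (e ℕ.+ d) → Poly
    row i = [ (λ r → shift (toℕ (opposite r)) p)
            , (λ r → shift (toℕ (opposite r)) q) ]′ (splitAt e i)

-- Laplace expansion along the first row.
module Determinant {a ℓ} (R : RawRing a ℓ) where
  open RawRing R
  open RawSemiringDefs rawSemiring using (sum; _^_)

  det : ∀ {n} → (Fin n → Fin n → Carrier) → Carrier
  det {zero}  A = 1#
  det {suc n} A = sum λ j →
    (- 1#) ^ toℕ j * (A zero j * det (λ r s → A (suc r) (punchIn j s)))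

module ℤ[X] = Polynomial ℤ.+-*-rawRing
module ℚ[X] = Polynomial ℚ.+-*-rawRing

open ℤ[X] using (Poly; const; X; _+ᴾ_; _-ᴾ_; _*ᴾ_; _^ᴾ_; derivative; sylvester)
open Determinant ℤ.+-*-rawRing using (det)

-- Ignores trailing zeros; the zero polynomial gets degree 0.
degree : Poly → ℕ
degree []      = 0
degree (x ∷ p) = if does (all? (ℤ._≟ 0ℤ) p) then 0 else suc (degree p)

resultant : Poly → Poly → ℤ
resultant p q = det (sylvester (degree p) (degree q) p q)

-- The discriminant of a monic polynomial (for leading coefficient ≢ 1 one would
-- have to divide by it).
discriminant : Poly → ℤ
discriminant p = -1ℤ ℤ.^ (degree p C 2) ℤ.* resultant p (derivative p)

IrreducibleOverℚ : Poly → Set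
IrreducibleOverℚ p = ℚ[X].Irreducible (map (ℚ._/ 1) p)

-- (x ^ k + c) ^ m - a x ^ n
f : (a c : ℤ) (k m n : ℕ) → Poly
f a c k m n = (X ^ᴾ k +ᴾ const c) ^ᴾ m -ᴾ const a *ᴾ X ^ᴾ n

{-# OPTIONS --safe #-}
-- Write P = x ^ k + c, so that f = P ^ m - a x ^ n. Differentiating,
--   x f′ = n f + P ^ (m - 1) Q  with  Q = (k m - n) x ^ k - n c,
-- hence Res(f , x) Res(f , f′) = Res(f , P) ^ (m - 1) Res(f , Q), where the factor
-- Res(f , x) = ± c ^ m is nonzero. Modulo P the polynomial f is - a x ^ n, which
-- reduces Res(f , P) to Res(P , x). Modulo Q, and up to a power of k m - n, the
-- power P ^ m is the constant (k m c) ^ m, which reduces Res(f , Q) to the resultant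
-- of two binomials; the Euclidean algorithm on their exponents evaluates it.
module Submission where

open import Defs
open import Data.Integer.Base using (ℤ; +_; 0ℤ; -1ℤ; _*_; _-_; _^_)
open import Data.Nat.Base as ℕ using (ℕ; _≤_; _<_; _∸_)
open import Data.Nat.Combinatorics using (_C_)
open import Data.Nat.GCD using (gcd)
open import Relation.Binary.PropositionalEquality.Core using (_≡_; _≢_)

open import Algebra.Definitions.RawSemiring Data.Integer.Base.+-*-rawSemiring using (sum) renaming (_^_ to _^′_)
open import Data.Fin.Base using (Fin; zero; suc; toℕ; punchIn; opposite; splitAt)
open import Data.Fin.Properties using (toℕ-fromℕ; toℕ-inject₁; toℕ<n)
open import Data.Integer.Base using (1ℤ; _+_; -_; ≢-nonZero)
import Data.Integer.Properties as ℤ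
open import Data.Integer.Properties using
  ( +-identityˡ; +-identityʳ; *-identityˡ; *-identityʳ; *-zeroˡ; *-zeroʳ; *-comm; *-assoc
  ; ^-distribˡ-+-*; ^-zeroˡ; ^-*-assoc; i^n≡0⇒i≡0; i*j≡0⇒i≡0∨j≡0; *-cancelˡ-≡; neg-injective; pos-*)
open import Data.Integer.Tactic.RingSolver using (solve-∀)
open import Data.List.Base using (List; []; _∷_; _++_; length; lookup; map; tabulate)
open import Data.List.Membership.Propositional using (_∈_)
open import Data.List.Membership.Propositional.Properties using (∈-lookup)
open import Data.List.Properties using
  (++-assoc; ++-identityʳ; length-++; map-++; tabulate-cong; tabulate-lookup)
open import Data.List.Relation.Binary.Pointwise as Pointwise using (Pointwise; []; _∷_)
open import Data.List.Relation.Unary.All as All using (All; []; _∷_; all?)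
open import Data.List.Relation.Unary.All.Properties using () renaming (++⁺ to All-++⁺)
open import Data.List.Relation.Unary.Any using (here; there)
open import Data.Nat.Base using (zero; suc; z≤n; s≤s)
open import Data.Nat.Coprimality using (Coprime)
open import Data.Nat.Divisibility using
  (_∣_; ∣-refl; _∣0; ∣m∣n⇒∣m+n; *-cancelʳ-∣; ∣1⇒≡1; *-monoˡ-∣)
open import Data.Nat.GCD using (gcd-greatest)
import Data.Nat.Properties as ℕ
open import Data.Product.Base using (∃; _,_; _×_)
open import Data.Sum.Base using ([_,_]′; inj₁; inj₂)
open import Data.Sum.Properties using ([,]-map)
open import Function.Base using (_∘_)
open import Relation.Binary.PropositionalEquality using
  (_≗_; refl; sym; trans; cong; cong₂; subst; subst₂; module ≡-Reasoning)
open import Relation.Nullary using (yes; no; contradiction)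

open Determinant Data.Integer.Base.+-*-rawRing using (det)
open ℤ[X] using (Poly; coeff; const; X; _+ᴾ_; _*ᴾ_; _^ᴾ_; derivative; shift; sylvester)
open ≡-Reasoning

-- A polynomial is given by its coefficient sequence and a square matrix by the
-- list of its rows, so that determinants are forms on List Seq.

-- The resultant is a Sylvester determinant over `ℤ`. The product formula over roots, which would
-- make multiplicativity and reduction immediate, needs a splitting field, so both are obtained from
-- row operations and from the uniqueness of the determinant. Multiplicativity is required only for
-- the monic factors `x ^ k + c` and for `x`, which is the case of exponent 1 and constant 0.
-- Reduction modulo `Q` meets a leading coefficient `k m - n` that is no unit: rows are first
-- multiplied by a power of it, and the surplus is cancelled at the end, since `n < k m` makes it
-- nonzero. Reduction also drops the degree while the number of rows stays, so resultants carry
-- formal degrees, and lowering one costs a power of a leading coefficient. The outer exponent `t`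
-- arises because the two final binomials are polynomials in `x ^ t`. The summand `n + t` in the
-- sign comes from `(1 + k₁ + n₁) t ≡ k n` modulo 2, which holds because `k₁` and `n₁` are not both
-- even.

Seq : Set
Seq = ℕ → ℤ

infixl 6 _⊕_
infixl 7 _⊙_

_⊕_ : Seq → Seq → Seq
(u ⊕ v) i = u i + v i

_⊙_ : ℤ → Seq → Seq
(x ⊙ u) i = x * u i

𝟘 : Seq
𝟘 _ = 0ℤ

-- Alternating forms on lists of rows

_≋_ : List Seq → List Seq → Set
_≋_ = Pointwise _≗_

≋-refl : ∀ us → us ≋ us
≋-refl us = Pointwise.refl (λ _ → refl) {us}

≋-at : ∀ us {u v} ws → u ≗ v → (us ++ u ∷ ws) ≋ (us ++ v ∷ ws)
≋-at []       ws e = e ∷ ≋-refl ws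
≋-at (x ∷ us) ws e = (λ _ → refl) ∷ ≋-at us ws e

-- `repeat` asks only for adjacent equal rows; `swap₁` and `annihilates-∈` extend this to all
-- positions. The lists have arbitrary length, so fixing some rows is composition with `us ++_`,
-- which keeps the form alternating and lets statements about the first row be used at any depth.
record Alternating (φ : List Seq → ℤ) : Set where
  field
    cong-≋ : ∀ {us vs} → us ≋ vs → φ us ≡ φ vs
    linear : ∀ us x u v ws →
      φ (us ++ (x ⊙ u ⊕ v) ∷ ws) ≡ x * φ (us ++ u ∷ ws) + φ (us ++ v ∷ ws)
    repeat : ∀ us u ws → φ (us ++ u ∷ u ∷ ws) ≡ 0ℤ

open Alternating

fix-head : ∀ {φ} u → Alternating φ → Alternating (φ ∘ (u ∷_))
fix-head u A .cong-≋ e       = A .cong-≋ ((λ _ → refl) ∷ e)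
fix-head u A .linear us      = A .linear (u ∷ us)
fix-head u A .repeat us      = A .repeat (u ∷ us)

fix-prefix : ∀ {φ} us → Alternating φ → Alternating (φ ∘ (us ++_))
fix-prefix []       A = A
fix-prefix (u ∷ us) A = fix-prefix us (fix-head u A)

module _ {φ : List Seq → ℤ} (A : Alternating φ) where

  linear₁ : ∀ x u v ws → φ ((x ⊙ u ⊕ v) ∷ ws) ≡ x * φ (u ∷ ws) + φ (v ∷ ws)
  linear₁ = A .linear []

  head-cong : ∀ {u v} ws → u ≗ v → φ (u ∷ ws) ≡ φ (v ∷ ws)
  head-cong ws e = A .cong-≋ (e ∷ ≋-refl ws)

  head-zero : ∀ ws → φ (𝟘 ∷ ws) ≡ 0ℤ
  head-zero ws = begin
    φ (𝟘 ∷ ws)                              ≡⟨ head-cong ws (λ _ → refl) ⟩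
    φ ((-1ℤ ⊙ 𝟘 ⊕ 𝟘) ∷ ws)                  ≡⟨ linear₁ -1ℤ 𝟘 𝟘 ws ⟩
    -1ℤ * φ (𝟘 ∷ ws) + φ (𝟘 ∷ ws)           ≡⟨ eq (φ (𝟘 ∷ ws)) ⟩
    0ℤ                                      ∎
    where
    eq : ∀ x → -1ℤ * x + x ≡ 0ℤ
    eq = solve-∀

  head-scale : ∀ x u ws → φ ((x ⊙ u) ∷ ws) ≡ x * φ (u ∷ ws)
  head-scale x u ws = begin
    φ ((x ⊙ u) ∷ ws)                ≡⟨ head-cong ws (λ i → sym (+-identityʳ _)) ⟩
    φ ((x ⊙ u ⊕ 𝟘) ∷ ws)            ≡⟨ linear₁ x u 𝟘 ws ⟩
    x * φ (u ∷ ws) + φ (𝟘 ∷ ws)     ≡⟨ cong (λ y → x * φ (u ∷ ws) + y) (head-zero ws) ⟩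
    x * φ (u ∷ ws) + 0ℤ             ≡⟨ +-identityʳ _ ⟩
    x * φ (u ∷ ws)                  ∎

  head-add : ∀ u v ws → φ ((u ⊕ v) ∷ ws) ≡ φ (u ∷ ws) + φ (v ∷ ws)
  head-add u v ws = begin
    φ ((u ⊕ v) ∷ ws)                ≡⟨ head-cong ws (λ i → cong (_+ v i) (sym (*-identityˡ (u i)))) ⟩
    φ ((1ℤ ⊙ u ⊕ v) ∷ ws)           ≡⟨ linear₁ 1ℤ u v ws ⟩
    1ℤ * φ (u ∷ ws) + φ (v ∷ ws)    ≡⟨ cong (_+ φ (v ∷ ws)) (*-identityˡ (φ (u ∷ ws))) ⟩
    φ (u ∷ ws) + φ (v ∷ ws)         ∎

-- Polarization: the form vanishes on the pair of rows `u ⊕ v`, `u ⊕ v`, and the expansion consists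
-- of two vanishing squares and the two mixed terms.
swap₁ : ∀ {φ} → Alternating φ → ∀ u v ws → φ (u ∷ v ∷ ws) ≡ -1ℤ * φ (v ∷ u ∷ ws)
swap₁ {φ} A u v ws = begin
  φ (u ∷ v ∷ ws)                   ≡⟨ eq₁ (φ (u ∷ v ∷ ws)) (φ (v ∷ u ∷ ws)) ⟩
  ((0ℤ + φ (u ∷ v ∷ ws)) + (φ (v ∷ u ∷ ws) + 0ℤ)) - φ (v ∷ u ∷ ws)
    ≡⟨ cong (λ x → (x + φ (u ∷ v ∷ ws) + (φ (v ∷ u ∷ ws) + 0ℤ)) - φ (v ∷ u ∷ ws)) (sym (A .repeat [] u ws)) ⟩
  ((φ (u ∷ u ∷ ws) + φ (u ∷ v ∷ ws)) + (φ (v ∷ u ∷ ws) + 0ℤ)) - φ (v ∷ u ∷ ws)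
    ≡⟨ cong (λ x → (φ (u ∷ u ∷ ws) + φ (u ∷ v ∷ ws) + (φ (v ∷ u ∷ ws) + x)) - φ (v ∷ u ∷ ws)) (sym (A .repeat [] v ws)) ⟩
  ((φ (u ∷ u ∷ ws) + φ (u ∷ v ∷ ws)) + (φ (v ∷ u ∷ ws) + φ (v ∷ v ∷ ws))) - φ (v ∷ u ∷ ws)
    ≡⟨ cong₂ (λ x y → x + y - φ (v ∷ u ∷ ws)) (sym (head-add (fix-head u A) u v ws)) (sym (head-add (fix-head v A) u v ws)) ⟩
  (φ (u ∷ (u ⊕ v) ∷ ws) + φ (v ∷ (u ⊕ v) ∷ ws)) - φ (v ∷ u ∷ ws)
    ≡⟨ cong (_- φ (v ∷ u ∷ ws)) (sym (head-add A u v ((u ⊕ v) ∷ ws))) ⟩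
  φ ((u ⊕ v) ∷ (u ⊕ v) ∷ ws) - φ (v ∷ u ∷ ws)
    ≡⟨ cong (_- φ (v ∷ u ∷ ws)) (A .repeat [] (u ⊕ v) ws) ⟩
  0ℤ - φ (v ∷ u ∷ ws)              ≡⟨ eq₂ (φ (v ∷ u ∷ ws)) ⟩
  -1ℤ * φ (v ∷ u ∷ ws)             ∎
  where
  eq₁ : ∀ x y → x ≡ ((0ℤ + x) + (y + 0ℤ)) - y
  eq₁ = solve-∀
  eq₂ : ∀ y → 0ℤ - y ≡ -1ℤ * y
  eq₂ = solve-∀

move : ∀ {φ} → Alternating φ → ∀ u vs ws →
       φ (u ∷ vs ++ ws) ≡ -1ℤ ^ length vs * φ (vs ++ u ∷ ws)
move A u []       ws = sym (*-identityˡ _)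
move {φ} A u (v ∷ vs) ws = begin
  φ (u ∷ v ∷ vs ++ ws)                               ≡⟨ swap₁ A u v (vs ++ ws) ⟩
  -1ℤ * φ (v ∷ u ∷ vs ++ ws)                         ≡⟨ cong (-1ℤ *_) (move (fix-head v A) u vs ws) ⟩
  -1ℤ * (-1ℤ ^ length vs * φ (v ∷ vs ++ u ∷ ws))     ≡⟨ eq (-1ℤ ^ length vs) _ ⟩
  -1ℤ ^ suc (length vs) * φ (v ∷ vs ++ u ∷ ws)       ∎
  where
  eq : ∀ x y → -1ℤ * (x * y) ≡ -1ℤ * x * y
  eq = solve-∀

swap-blocks : ∀ {φ} → Alternating φ → ∀ us vs ws →
  φ (us ++ vs ++ ws) ≡ -1ℤ ^ (length us ℕ.* length vs) * φ (vs ++ us ++ ws)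
swap-blocks A []       vs ws = sym (*-identityˡ _)
swap-blocks {φ} A (u ∷ us) vs ws = begin
  φ (u ∷ us ++ vs ++ ws)
    ≡⟨ swap-blocks (fix-head u A) us vs ws ⟩
  -1ℤ ^ (length us ℕ.* length vs) * φ (u ∷ vs ++ us ++ ws)
    ≡⟨ cong (-1ℤ ^ (length us ℕ.* length vs) *_) (move A u vs (us ++ ws)) ⟩
  -1ℤ ^ (length us ℕ.* length vs) * (-1ℤ ^ length vs * φ (vs ++ u ∷ us ++ ws))
    ≡⟨ eq (-1ℤ ^ (length us ℕ.* length vs)) (-1ℤ ^ length vs) _ ⟩
  -1ℤ ^ length vs * -1ℤ ^ (length us ℕ.* length vs) * φ (vs ++ u ∷ us ++ ws)
    ≡⟨ cong (_* φ (vs ++ u ∷ us ++ ws)) (sym (^-distribˡ-+-* -1ℤ (length vs) _)) ⟩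
  -1ℤ ^ (length vs ℕ.+ length us ℕ.* length vs) * φ (vs ++ u ∷ us ++ ws)  ∎
  where
  eq : ∀ x y z → x * (y * z) ≡ y * x * z
  eq = solve-∀

-- Rows on which a form vanishes, and row reduction

Annihilates : (List Seq → ℤ) → Seq → Set
Annihilates φ z = ∀ ws → φ (z ∷ ws) ≡ 0ℤ

annihilates-fix : ∀ {φ z} u → Alternating φ → Annihilates φ z → Annihilates (φ ∘ (u ∷_)) z
annihilates-fix {φ} {z} u A Z ws = begin
  φ (u ∷ z ∷ ws)         ≡⟨ swap₁ A u z ws ⟩
  -1ℤ * φ (z ∷ u ∷ ws)   ≡⟨ cong (-1ℤ *_) (Z (u ∷ ws)) ⟩
  0ℤ                     ∎

annihilates-self : ∀ {φ} u → Alternating φ → Annihilates (φ ∘ (u ∷_)) u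
annihilates-self u A ws = A .repeat [] u ws

annihilates-prefix : ∀ {φ z} us → Alternating φ → Annihilates φ z → Annihilates (φ ∘ (us ++_)) z
annihilates-prefix []       A Z = Z
annihilates-prefix (u ∷ us) A Z = annihilates-prefix us (fix-head u A) (annihilates-fix u A Z)

annihilates-∈ : ∀ {φ u} us → Alternating φ → u ∈ us → Annihilates (φ ∘ (us ++_)) u
annihilates-∈ (u ∷ us) A (here refl) = annihilates-prefix us (fix-head u A) (annihilates-self u A)
annihilates-∈ (v ∷ us) A (there p)   = annihilates-∈ us (fix-head v A) p

-- `comb` has the shape of `linear`, so vanishing on generators passes to the span by induction.
-- `cong-≗` is a constructor because sequences are compared pointwise, without function
-- extensionality.
data Span (P : Seq → Set) : Seq → Set where
  gen  : ∀ {u} → P u → Span P u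
  null : Span P 𝟘
  comb : ∀ x {u v} → Span P u → Span P v → Span P (x ⊙ u ⊕ v)
  cong-≗ : ∀ {u v} → u ≗ v → Span P u → Span P v

annihilates-span : ∀ {φ P z} → Alternating φ → (∀ {u} → P u → Annihilates φ u) →
                   Span P z → Annihilates φ z
annihilates-span A Z (gen p)          ws = Z p ws
annihilates-span A Z null             ws = head-zero A ws
annihilates-span {φ} A Z (comb x {u} {v} p q) ws = begin
  φ ((x ⊙ u ⊕ v) ∷ ws)           ≡⟨ linear₁ A x u v ws ⟩
  x * φ (u ∷ ws) + φ (v ∷ ws)    ≡⟨ cong₂ (λ y z → x * y + z) (annihilates-span A Z p ws) (annihilates-span A Z q ws) ⟩
  x * 0ℤ + 0ℤ                    ≡⟨ cong (_+ 0ℤ) (*-zeroʳ x) ⟩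
  0ℤ                             ∎
annihilates-span A Z (cong-≗ e p)       ws = trans (head-cong A ws (λ i → sym (e i))) (annihilates-span A Z p ws)

-- Row reduction without division: each row is scaled by `x` and then changed by an annihilated row,
-- at the price of one factor `x` per row. This permits reduction by a polynomial whose leading
-- coefficient is not a unit.
reduce : ∀ {φ} (Z : Seq → Set) → Alternating φ → (∀ {z} → Z z → Annihilates φ z) →
         ∀ x {vs ws} →
         Pointwise (λ v w → Z (x ⊙ v ⊕ -1ℤ ⊙ w)) vs ws →
         x ^ length vs * φ vs ≡ φ ws
reduce Z A K x [] = *-identityˡ _
reduce {φ} Z A K x {v ∷ vs} {w ∷ ws} (z ∷ zs) = begin
  x * x ^ length vs * φ (v ∷ vs)         ≡⟨ eq x (x ^ length vs) _ ⟩
  x ^ length vs * (x * φ (v ∷ vs))       ≡⟨ cong (x ^ length vs *_) (sym (head-scale A x v vs)) ⟩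
  x ^ length vs * φ ((x ⊙ v) ∷ vs)       ≡⟨ cong (x ^ length vs *_) (head-cong A vs (λ i → eq₂ (x * v i) (w i))) ⟩
  x ^ length vs * φ ((1ℤ ⊙ (x ⊙ v ⊕ -1ℤ ⊙ w) ⊕ w) ∷ vs)
    ≡⟨ cong (x ^ length vs *_) (linear₁ A 1ℤ (x ⊙ v ⊕ -1ℤ ⊙ w) w vs) ⟩
  x ^ length vs * (1ℤ * φ ((x ⊙ v ⊕ -1ℤ ⊙ w) ∷ vs) + φ (w ∷ vs))
    ≡⟨ cong (λ y → x ^ length vs * (1ℤ * y + φ (w ∷ vs))) (K z vs) ⟩
  x ^ length vs * (1ℤ * 0ℤ + φ (w ∷ vs)) ≡⟨ cong (x ^ length vs *_) (+-identityˡ _) ⟩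
  x ^ length vs * φ (w ∷ vs)             ≡⟨ reduce Z (fix-head w A) (λ y → annihilates-fix w A (K y)) x zs ⟩
  φ (w ∷ ws)                             ∎
  where
  eq : ∀ x y z → x * y * z ≡ y * (x * z)
  eq = solve-∀
  eq₂ : ∀ x w → x ≡ 1ℤ * (x + -1ℤ * w) + w
  eq₂ = solve-∀

-- Expansion along the column of coefficients of index n: the product of the
-- linear form u ↦ u n with the form φ.
wedge : ℕ → (List Seq → ℤ) → List Seq → ℤ
wedge n φ []       = 0ℤ
wedge n φ (v ∷ vs) = v n * φ vs - wedge n (φ ∘ (v ∷_)) vs

wedge-ext : ∀ n {φ ψ} → φ ≗ ψ → wedge n φ ≗ wedge n ψ
wedge-ext n e []       = refl
wedge-ext n e (v ∷ vs) = cong₂ (λ x y → v n * x - y) (e vs) (wedge-ext n (e ∘ (v ∷_)) vs)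

wedge-comb : ∀ n x φ ψ vs →
  wedge n (λ ws → x * φ ws + ψ ws) vs ≡ x * wedge n φ vs + wedge n ψ vs
wedge-comb n x φ ψ [] = sym (cong (_+ 0ℤ) (*-zeroʳ x))
wedge-comb n x φ ψ (v ∷ vs) = trans
  (cong (λ y → v n * (x * φ vs + ψ vs) - y) (wedge-comb n x (φ ∘ (v ∷_)) (ψ ∘ (v ∷_)) vs))
  (eq x (v n) (φ vs) (ψ vs) _ _)
  where
  eq : ∀ x v p q y z → v * (x * p + q) - (x * y + z) ≡ x * (v * p - y) + (v * q - z)
  eq = solve-∀

wedge-null : ∀ n {φ} → (∀ ws → φ ws ≡ 0ℤ) → ∀ vs → wedge n φ vs ≡ 0ℤ
wedge-null n e []       = refl
wedge-null n e (v ∷ vs) = trans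
  (cong₂ (λ x y → v n * x - y) (e vs) (wedge-null n (e ∘ (v ∷_)) vs))
  (cong (_- 0ℤ) (*-zeroʳ (v n)))

wedge-annihilated : ∀ n φ {vs} → All (λ v → v n ≡ 0ℤ) vs → wedge n φ vs ≡ 0ℤ
wedge-annihilated n φ []                 = refl
wedge-annihilated n φ {v ∷ vs} (z ∷ zs) =
  trans (cong₂ (λ x y → x * φ vs - y) z (wedge-annihilated n (φ ∘ (v ∷_)) zs))
        (cong (_- 0ℤ) (*-zeroˡ (φ vs)))

wedge-cong : ∀ n {φ ψ} {R : Seq → Seq → Set} → (∀ {u v} → R u v → u n ≡ v n) →
  (∀ {us vs} → Pointwise R us vs → φ us ≡ ψ vs) →
  ∀ {us vs} → Pointwise R us vs → wedge n φ us ≡ wedge n ψ vs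
wedge-cong n at e []       = refl
wedge-cong n at e (r ∷ rs) =
  cong₂ _-_ (cong₂ _*_ (at r) (e rs)) (wedge-cong n at (e ∘ (r ∷_)) rs)

wedge-alternating : ∀ n {φ} → Alternating φ → Alternating (wedge n φ)
wedge-alternating n A .cong-≋ = wedge-cong n (λ e → e n) (A .cong-≋)
wedge-alternating n {φ} A .linear [] x u v ws = trans
  (cong (λ y → (x * u n + v n) * φ ws - y)
    (trans (wedge-ext n (λ vs → A .linear [] x u v vs) ws)
           (wedge-comb n x (φ ∘ (u ∷_)) (φ ∘ (v ∷_)) ws)))
  (eq x (u n) (v n) (φ ws) _ _)
  where
  eq : ∀ x u v p y z → (x * u + v) * p - (x * y + z) ≡ x * (u * p - y) + (v * p - z)
  eq = solve-∀
wedge-alternating n {φ} A .linear (p ∷ us) x u v ws = trans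
  (cong₂ (λ y z → p n * y - z) (A .linear us x u v ws)
    (wedge-alternating n (fix-head p A) .linear us x u v ws))
  (eq x (p n) (φ (us ++ u ∷ ws)) (φ (us ++ v ∷ ws)) _ _)
  where
  eq : ∀ x p a b y z → p * (x * a + b) - (x * y + z) ≡ x * (p * a - y) + (p * b - z)
  eq = solve-∀
-- The two terms with the factor `u n` cancel; what is left expands a form that vanishes
-- identically.
wedge-alternating n {φ} A .repeat [] u ws = trans
  (cong (λ y → u n * φ (u ∷ ws) - (u n * φ (u ∷ ws) - y)) (wedge-null n (A .repeat [] u) ws))
  (eq (u n * φ (u ∷ ws)))
  where
  eq : ∀ x → x - (x - 0ℤ) ≡ 0ℤ
  eq = solve-∀
wedge-alternating n {φ} A .repeat (p ∷ us) u ws = trans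
  (cong₂ (λ y z → p n * y - z) (A .repeat us u ws) (wedge-alternating n (fix-head p A) .repeat us u ws))
  (cong (_- 0ℤ) (*-zeroʳ (p n)))

-- The determinant of n rows, whose columns are the coefficients of index
-- n - 1 , … , 1 , 0; it vanishes on lists of any other length.
Det : ℕ → List Seq → ℤ
Det zero    []      = 1ℤ
Det zero    (_ ∷ _) = 0ℤ
Det (suc n) vs      = wedge n (Det n) vs

Det-alternating : ∀ n → Alternating (Det n)
Det-alternating zero .cong-≋ []      = refl
Det-alternating zero .cong-≋ (_ ∷ _) = refl
Det-alternating zero .linear [] x u v ws      = sym (cong (_+ 0ℤ) (*-zeroʳ x))
Det-alternating zero .linear (_ ∷ _) x u v ws = sym (cong (_+ 0ℤ) (*-zeroʳ x))
Det-alternating zero .repeat [] u ws      = refl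
Det-alternating zero .repeat (_ ∷ _) u ws = refl
Det-alternating (suc n) = wedge-alternating n (Det-alternating n)

Agree : ℕ → Seq → Seq → Set
Agree n u v = ∀ i → i < n → u i ≡ v i

Det-cong : ∀ n {us vs} → Pointwise (Agree n) us vs → Det n us ≡ Det n vs
Det-cong zero    []      = refl
Det-cong zero    (_ ∷ _) = refl
Det-cong (suc n) rs =
  wedge-cong n (λ r → r n ℕ.≤-refl)
    (λ qs → Det-cong n (Pointwise.map (λ r i i<n → r i (ℕ.m<n⇒m<1+n i<n)) qs)) rs

Det-strip : ∀ n v {vs} → All (λ u → u n ≡ 0ℤ) vs → Det (suc n) (v ∷ vs) ≡ v n * Det n vs
Det-strip n v {vs} zs =
  trans (cong (λ y → v n * Det n vs - y) (wedge-annihilated n (Det n ∘ (v ∷_)) zs)) (+-identityʳ _)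

-- Uniqueness of the determinant

lc : ∀ {n} → (Fin n → ℤ) → (Fin n → Seq) → Seq
lc {zero}  A b = 𝟘
lc {suc n} A b = A zero ⊙ b zero ⊕ lc (A ∘ suc) (b ∘ suc)

lc-cong : ∀ {n} {A A′ : Fin n → ℤ} {b b′ : Fin n → Seq} →
          A ≗ A′ → (∀ j → b j ≗ b′ j) → lc A b ≗ lc A′ b′
lc-cong {zero}  e h i = refl
lc-cong {suc n} e h i = cong₂ _+_ (cong₂ _*_ (e zero) (h zero i)) (lc-cong (e ∘ suc) (h ∘ suc) i)

lc-punchIn : ∀ {n} (j : Fin (suc n)) A b →
             lc A b ≗ (A j ⊙ b j ⊕ lc (A ∘ punchIn j) (b ∘ punchIn j))
lc-punchIn zero A b i = refl
lc-punchIn {suc n} (suc j) A b i = trans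
  (cong (λ y → A zero * b zero i + y) (lc-punchIn j (A ∘ suc) (b ∘ suc) i))
  (eq (A zero * b zero i) (A (suc j) * b (suc j) i) _)
  where
  eq : ∀ x y z → x + (y + z) ≡ y + (x + z)
  eq = solve-∀

head-lc : ∀ {φ} → Alternating φ → ∀ {n} A (b : Fin n → Seq) ws →
          φ (lc A b ∷ ws) ≡ sum (λ j → A j * φ (b j ∷ ws))
head-lc Φ {zero}  A b ws = head-zero Φ ws
head-lc {φ} Φ {suc n} A b ws = trans
  (linear₁ Φ (A zero) (b zero) (lc (A ∘ suc) (b ∘ suc)) ws)
  (cong (λ y → A zero * φ (b zero ∷ ws) + y) (head-lc Φ (A ∘ suc) (b ∘ suc) ws))

sum-cong : ∀ {n} {g h : Fin n → ℤ} → g ≗ h → sum g ≡ sum h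
sum-cong {zero}  e = refl
sum-cong {suc n} e = cong₂ _+_ (e zero) (sum-cong (e ∘ suc))

sum-*ʳ : ∀ {n} (g : Fin n → ℤ) x → sum (λ j → g j * x) ≡ sum g * x
sum-*ʳ {zero}  g x = refl
sum-*ʳ {suc n} g x = trans (cong (λ y → g zero * x + y) (sum-*ʳ (g ∘ suc) x)) (eq (g zero) (sum (g ∘ suc)) x)
  where
  eq : ∀ a b x → a * x + b * x ≡ (a + b) * x
  eq = solve-∀

-- The sign is written with `_^′_`, the power occurring in the definition of `det`, so that the
-- cofactor sum in `det-unique` is literally `det A`.
move-front : ∀ {φ} → Alternating φ → ∀ {n} (j : Fin (suc n)) (b : Fin (suc n) → Seq) →
             φ (b j ∷ tabulate (b ∘ punchIn j)) ≡ -1ℤ ^′ toℕ j * φ (tabulate b)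
move-front Φ zero b = sym (*-identityˡ _)
move-front {φ} Φ {suc n} (suc j) b = begin
  φ (b (suc j) ∷ b zero ∷ tabulate (b ∘ suc ∘ punchIn j))
    ≡⟨ swap₁ Φ (b (suc j)) (b zero) _ ⟩
  -1ℤ * φ (b zero ∷ b (suc j) ∷ tabulate (b ∘ suc ∘ punchIn j))
    ≡⟨ cong (-1ℤ *_) (move-front (fix-head (b zero) Φ) j (b ∘ suc)) ⟩
  -1ℤ * (-1ℤ ^′ toℕ j * φ (tabulate b))
    ≡⟨ sym (*-assoc -1ℤ (-1ℤ ^′ toℕ j) (φ (tabulate b))) ⟩
  -1ℤ ^′ suc (toℕ j) * φ (tabulate b) ∎

reduce₁ : ∀ {φ} (Z : Seq → Set) → Alternating φ → (∀ {z} → Z z → Annihilates φ z) →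
          ∀ {vs ws} → Pointwise (λ v w → Z (1ℤ ⊙ v ⊕ -1ℤ ⊙ w)) vs ws → φ vs ≡ φ ws
reduce₁ {φ} Z Φ K {vs} {ws} zs = begin
  φ vs                         ≡⟨ sym (*-identityˡ (φ vs)) ⟩
  1ℤ * φ vs                    ≡⟨ cong (_* φ vs) (sym (^-zeroˡ (length vs))) ⟩
  1ℤ ^ length vs * φ vs        ≡⟨ reduce Z Φ K 1ℤ zs ⟩
  φ ws                         ∎

det-unique : ∀ {φ} → Alternating φ → ∀ {n} (A : Fin n → Fin n → ℤ) b →
             φ (tabulate (λ i → lc (A i) b)) ≡ det A * φ (tabulate b)
det-unique Φ {zero} A b = sym (*-identityˡ _)
det-unique {φ} Φ {suc n} A b = begin
  φ (lc (A zero) b ∷ rows)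
    ≡⟨ head-lc Φ (A zero) b rows ⟩
  sum (λ j → A zero j * φ (b j ∷ rows))
    ≡⟨ sum-cong (λ j → cong (A zero j *_) (cofactor j)) ⟩
  sum (λ j → A zero j * (det (minor j) * (-1ℤ ^′ toℕ j * φ (tabulate b))))
    ≡⟨ sum-cong (λ j → eq (A zero j) (det (minor j)) (-1ℤ ^′ toℕ j) (φ (tabulate b))) ⟩
  sum (λ j → -1ℤ ^′ toℕ j * (A zero j * det (minor j)) * φ (tabulate b))
    ≡⟨ sum-*ʳ (λ j → -1ℤ ^′ toℕ j * (A zero j * det (minor j))) (φ (tabulate b)) ⟩
  det A * φ (tabulate b) ∎
  where
  rows = tabulate (λ i → lc (A (suc i)) b)
  minor : Fin (suc n) → Fin n → Fin n → ℤ
  minor j r s = A (suc r) (punchIn j s)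
  eq : ∀ a d s x → a * (d * (s * x)) ≡ s * (a * d) * x
  eq = solve-∀
  eq₂ : ∀ x y → 1ℤ * (x + y) + -1ℤ * y ≡ x
  eq₂ = solve-∀
  cofactor : ∀ j → φ (b j ∷ rows) ≡ det (minor j) * (-1ℤ ^′ toℕ j * φ (tabulate b))
  cofactor j = begin
    φ (b j ∷ rows)
      ≡⟨ reduce₁ (λ z → ∃ λ x → z ≗ x ⊙ b j) (fix-head (b j) Φ) kills (Pointwise.tabulate⁺ diff) ⟩
    φ (b j ∷ tabulate (λ i → lc (minor j i) (b ∘ punchIn j)))
      ≡⟨ det-unique (fix-head (b j) Φ) (minor j) (b ∘ punchIn j) ⟩
    det (minor j) * φ (b j ∷ tabulate (b ∘ punchIn j))
      ≡⟨ cong (det (minor j) *_) (move-front Φ j b) ⟩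
    det (minor j) * (-1ℤ ^′ toℕ j * φ (tabulate b)) ∎
    where
    kills : ∀ {z} → (∃ λ x → z ≗ x ⊙ b j) → Annihilates (φ ∘ (b j ∷_)) z
    kills (x , e) ws = begin
      φ (b j ∷ _ ∷ ws)           ≡⟨ head-cong (fix-head (b j) Φ) ws e ⟩
      φ (b j ∷ (x ⊙ b j) ∷ ws)   ≡⟨ head-scale (fix-head (b j) Φ) x (b j) ws ⟩
      x * φ (b j ∷ b j ∷ ws)     ≡⟨ cong (x *_) (Φ .repeat [] (b j) ws) ⟩
      x * 0ℤ                     ≡⟨ *-zeroʳ x ⟩
      0ℤ                         ∎
    diff : ∀ i → ∃ λ x → (1ℤ ⊙ lc (A (suc i)) b ⊕ -1ℤ ⊙ lc (minor j i) (b ∘ punchIn j)) ≗ x ⊙ b j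
    diff i = A (suc i) j , λ l → trans
      (cong (λ y → 1ℤ * y + -1ℤ * lc (minor j i) (b ∘ punchIn j) l) (lc-punchIn j (A (suc i)) b l))
      (eq₂ (A (suc i) j * b j l) (lc (minor j i) (b ∘ punchIn j) l))

-- Multiplication by powers of x

one : Seq
one zero    = 1ℤ
one (suc _) = 0ℤ

shift₁ : Seq → Seq
shift₁ w zero    = 0ℤ
shift₁ w (suc i) = w i

x^_∙_ : ℕ → Seq → Seq
x^ zero  ∙ w = w
x^ suc k ∙ w = shift₁ (x^ k ∙ w)

shift₁-cong : ∀ {u v} → u ≗ v → shift₁ u ≗ shift₁ v
shift₁-cong e zero    = refl
shift₁-cong e (suc i) = e i

x^-cong : ∀ k {u v} → u ≗ v → x^ k ∙ u ≗ x^ k ∙ v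
x^-cong zero    e = e
x^-cong (suc k) e = shift₁-cong (x^-cong k e)

x^-comb : ∀ k x u v → x^ k ∙ (x ⊙ u ⊕ v) ≗ (x ⊙ (x^ k ∙ u) ⊕ (x^ k ∙ v))
x^-comb zero    x u v i       = refl
x^-comb (suc k) x u v zero    = sym (cong (_+ 0ℤ) (*-zeroʳ x))
x^-comb (suc k) x u v (suc i) = x^-comb k x u v i

x^-𝟘 : ∀ k → x^ k ∙ 𝟘 ≗ 𝟘
x^-𝟘 zero    i       = refl
x^-𝟘 (suc k) zero    = refl
x^-𝟘 (suc k) (suc i) = x^-𝟘 k i

x^-scale : ∀ k x u → x^ k ∙ (x ⊙ u) ≗ x ⊙ (x^ k ∙ u)
x^-scale zero    x u i       = refl
x^-scale (suc k) x u zero    = sym (*-zeroʳ x)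
x^-scale (suc k) x u (suc i) = x^-scale k x u i

x^-+ : ∀ j k w → x^ (j ℕ.+ k) ∙ w ≡ x^ j ∙ (x^ k ∙ w)
x^-+ zero    k w = refl
x^-+ (suc j) k w = cong shift₁ (x^-+ j k w)

x^-comm : ∀ j k w → x^ j ∙ (x^ k ∙ w) ≡ x^ k ∙ (x^ j ∙ w)
x^-comm j k w = begin
  x^ j ∙ (x^ k ∙ w)      ≡⟨ x^-+ j k w ⟨
  x^ (j ℕ.+ k) ∙ w       ≡⟨ cong (x^_∙ w) (ℕ.+-comm j k) ⟩
  x^ (k ℕ.+ j) ∙ w       ≡⟨ x^-+ k j w ⟩
  x^ k ∙ (x^ j ∙ w)      ∎

x^-coeff : ∀ k w i → (x^ k ∙ w) (k ℕ.+ i) ≡ w i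
x^-coeff zero    w i = refl
x^-coeff (suc k) w i = x^-coeff k w i

x^-coeff-< : ∀ k w {i} → i < k → (x^ k ∙ w) i ≡ 0ℤ
x^-coeff-< (suc k) w {zero}  _         = refl
x^-coeff-< (suc k) w {suc i} (s≤s i<k) = x^-coeff-< k w i<k

-- Supports of sequences and blocks of shifts

Below : ℕ → Seq → Set
Below n w = ∀ i → n ≤ i → w i ≡ 0ℤ

below-≤ : ∀ {m n w} → m ≤ n → Below m w → Below n w
below-≤ m≤n b i n≤i = b i (ℕ.≤-trans m≤n n≤i)

below-one : Below 1 one
below-one (suc i) _ = refl

below-x^ : ∀ k {n w} → Below n w → Below (k ℕ.+ n) (x^ k ∙ w)
below-x^ zero    b i       n≤i       = b i n≤i
below-x^ (suc k) b (suc i) (s≤s n≤i) = below-x^ k b i n≤i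

below-comb : ∀ {n} x {u v} → Below n u → Below n v → Below n (x ⊙ u ⊕ v)
below-comb x b c i n≤i = trans (cong₂ (λ y z → x * y + z) (b i n≤i) (c i n≤i)) (cong (_+ 0ℤ) (*-zeroʳ x))

below-scale : ∀ {n} x {u} → Below n u → Below n (x ⊙ u)
below-scale x b i n≤i = trans (cong (x *_) (b i n≤i)) (*-zeroʳ x)

block : ℕ → Seq → List Seq
block zero    p = []
block (suc e) p = x^ e ∙ p ∷ block e p

length-block : ∀ e p → length (block e p) ≡ e
length-block zero    p = refl
length-block (suc e) p = cong suc (length-block e p)

block-++ : ∀ j e p → block (j ℕ.+ e) p ≡ block j (x^ e ∙ p) ++ block e p
block-++ zero    e p = refl
block-++ (suc j) e p = cong₂ _∷_ (x^-+ j e p) (block-++ j e p)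

block-All : ∀ {P : Seq → Set} e p → (∀ j → j < e → P (x^ j ∙ p)) → All P (block e p)
block-All zero    p h = []
block-All (suc e) p h = h e ℕ.≤-refl ∷ block-All e p (λ j j<e → h j (ℕ.m<n⇒m<1+n j<e))

block-Pointwise : ∀ {R : Seq → Seq → Set} e p q → (∀ j → j < e → R (x^ j ∙ p) (x^ j ∙ q)) →
                  Pointwise R (block e p) (block e q)
block-Pointwise zero    p q h = []
block-Pointwise (suc e) p q h = h e ℕ.≤-refl ∷ block-Pointwise e p q (λ j j<e → h j (ℕ.m<n⇒m<1+n j<e))

∈-block : ∀ {e} p {j} → j < e → x^ j ∙ p ∈ block e p
∈-block {suc e} p {j} j<1+e with j ℕ.≟ e
... | yes refl = here refl
... | no  j≢e  = there (∈-block p (ℕ.≤∧≢⇒< (ℕ.≤-pred j<1+e) j≢e))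

tabulate-block : ∀ e p → tabulate {n = e} (λ r → x^ toℕ (opposite r) ∙ p) ≡ block e p
tabulate-block zero    p = refl
tabulate-block (suc e) p = cong₂ _∷_ (cong (x^_∙ p) (toℕ-fromℕ e)) (trans
  (tabulate-cong (λ r → cong (x^_∙ p) (toℕ-inject₁ (opposite r))))
  (tabulate-block e p))

all-below-coeff : ∀ {n us} → All (Below n) us → All (λ u → u n ≡ 0ℤ) us
all-below-coeff = All.map (λ b → b _ ℕ.≤-refl)

block-one-below : ∀ n → All (Below n) (block n one)
block-one-below n = block-All n one (λ j j<n →
  below-≤ (subst (_≤ n) (ℕ.+-comm 1 j) j<n) (below-x^ j below-one))

x^-top : ∀ k w → (x^ k ∙ w) k ≡ w 0
x^-top k w = trans (cong (x^ k ∙ w) (sym (ℕ.+-identityʳ k))) (x^-coeff k w 0)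

Det-block-one : ∀ n → Det n (block n one) ≡ 1ℤ
Det-block-one zero    = refl
Det-block-one (suc n) = begin
  Det (suc n) (x^ n ∙ one ∷ block n one)  ≡⟨ Det-strip n (x^ n ∙ one) (all-below-coeff (block-one-below n)) ⟩
  (x^ n ∙ one) n * Det n (block n one)    ≡⟨ cong₂ _*_ (x^-top n one) (Det-block-one n) ⟩
  1ℤ                                      ∎

-- Alternating forms evaluated on the monomials

monomials : ∀ n → Fin n → Seq
monomials n j = x^ toℕ (opposite j) ∙ one

-- the columns are numbered by decreasing exponent
entries : ∀ {n} → Seq → Fin n → ℤ
entries w j = w (toℕ (opposite j))

lc-entries-suc : ∀ n w → lc (entries {suc n} w) (monomials (suc n)) ≗
                 (w n ⊙ (x^ n ∙ one) ⊕ lc (entries {n} w) (monomials n))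
lc-entries-suc n w i = cong₂ _+_
  (cong (λ l → w l * (x^ l ∙ one) i) (toℕ-fromℕ n))
  (lc-cong {n} (λ j → cong w (toℕ-inject₁ (opposite j)))
               (λ j l → cong (λ k → (x^ k ∙ one) l) (toℕ-inject₁ (opposite j))) i)

lc-entries-below : ∀ n w → Below n (lc (entries {n} w) (monomials n))
lc-entries-below zero    w i _ = refl
lc-entries-below (suc n) w i n<i = trans (lc-entries-suc n w i) (below-comb (w n)
  (below-≤ (ℕ.≤-reflexive (ℕ.+-comm n 1)) (below-x^ n below-one))
  (below-≤ (ℕ.n≤1+n n) (lc-entries-below n w)) i n<i)

lc-entries : ∀ n w → Agree n (lc (entries {n} w) (monomials n)) w
lc-entries (suc n) w i i<1+n with i ℕ.≟ n
... | yes refl = begin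
  lc (entries {suc n} w) (monomials (suc n)) n   ≡⟨ lc-entries-suc n w n ⟩
  w n * (x^ n ∙ one) n + lc (entries {n} w) (monomials n) n
    ≡⟨ cong₂ (λ y z → w n * y + z) (x^-top n one) (lc-entries-below n w n ℕ.≤-refl) ⟩
  w n * 1ℤ + 0ℤ                                  ≡⟨ trans (+-identityʳ _) (*-identityʳ _) ⟩
  w n                                            ∎
... | no i≢n = begin
  lc (entries {suc n} w) (monomials (suc n)) i   ≡⟨ lc-entries-suc n w i ⟩
  w n * (x^ n ∙ one) i + lc (entries {n} w) (monomials n) i
    ≡⟨ cong₂ (λ y z → w n * y + z) (x^-coeff-< n one i<n) (lc-entries n w i i<n) ⟩
  w n * 0ℤ + w i                                 ≡⟨ cong (_+ w i) (*-zeroʳ (w n)) ⟩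
  0ℤ + w i                                       ≡⟨ +-identityˡ _ ⟩
  w i                                            ∎
  where i<n = ℕ.≤∧≢⇒< (ℕ.≤-pred i<1+n) i≢n

lc-entries-all : ∀ n {w} → Below n w → lc (entries {n} w) (monomials n) ≗ w
lc-entries-all n {w} b i with n ℕ.≤? i
... | yes n≤i = trans (lc-entries-below n w i n≤i) (sym (b i n≤i))
... | no  n≰i = lc-entries n w i (ℕ.≰⇒> n≰i)

det-rows : ∀ {φ} → Alternating φ → ∀ n (rows : Fin n → Seq) →
  φ (tabulate (λ i → lc (entries (rows i)) (monomials n))) ≡
  det (λ i → entries (rows i)) * φ (block n one)
det-rows {φ} Φ n rows = trans (det-unique Φ (λ i → entries (rows i)) (monomials n))
  (cong (λ us → det (λ i → entries (rows i)) * φ us) (tabulate-block n one))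

-- `Det n` sees only the coefficients of index below `n`, so the rows may be truncated to
-- combinations of monomials. There uniqueness applies, and `Det n` is normalized to 1 on the
-- monomials.
Det-det : ∀ n (rows : Fin n → Seq) → Det n (tabulate rows) ≡ det (λ i → entries (rows i))
Det-det n rows = begin
  Det n (tabulate rows)
    ≡⟨ Det-cong n (Pointwise.tabulate⁺ (λ r i i<n → sym (lc-entries n (rows r) i i<n))) ⟩
  Det n (tabulate (λ i → lc (entries (rows i)) (monomials n)))
    ≡⟨ det-rows (Det-alternating n) n rows ⟩
  det (λ i → entries (rows i)) * Det n (block n one)
    ≡⟨ cong (det (λ i → entries (rows i)) *_) (Det-block-one n) ⟩
  det (λ i → entries (rows i)) * 1ℤ
    ≡⟨ *-identityʳ _ ⟩
  det (λ i → entries (rows i)) ∎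

-- Rows supported below `n` are combinations of `n` monomials, so a single value determines the form
-- on them. This takes the place of a product over roots when `Res-binom` compares two forms.
Det-unique : ∀ {φ} → Alternating φ → ∀ n us → length us ≡ n → All (Below n) us →
             φ us ≡ Det n us * φ (block n one)
Det-unique {φ} Φ n us refl bs = begin
  φ us                       ≡⟨ cong φ (tabulate-lookup us) ⟨
  φ (tabulate rows)          ≡⟨ Φ .cong-≋ (Pointwise.tabulate⁺ (λ r i → sym (lc-entries-all n (All.lookup bs (∈-lookup r)) i))) ⟩
  φ (tabulate (λ i → lc (entries (rows i)) (monomials n)))
                             ≡⟨ det-rows Φ n rows ⟩
  det (λ i → entries (rows i)) * φ (block n one)
                             ≡⟨ cong (_* φ (block n one)) (Det-det n rows) ⟨
  Det n (tabulate rows) * φ (block n one)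
                             ≡⟨ cong (λ vs → Det n vs * φ (block n one)) (tabulate-lookup us) ⟩
  Det n us * φ (block n one) ∎
  where
  rows = lookup us

-- The resultant of p and q, of formal degrees d and e.
Res : ℕ → ℕ → Seq → Seq → ℤ
Res d e p q = Det (e ℕ.+ d) (block e p ++ block d q)

-- Resultants as Sylvester determinants

coeff-shift : ∀ s p → coeff (shift s p) ≗ x^ s ∙ coeff p
coeff-shift zero    p i       = refl
coeff-shift (suc s) p zero    = refl
coeff-shift (suc s) p (suc i) = coeff-shift s p i

tabulate-splitAt : ∀ {B : Set} e {d} (g : Fin e → B) (h : Fin d → B) →
  tabulate (λ i → [ g , h ]′ (splitAt e i)) ≡ tabulate g ++ tabulate h
tabulate-splitAt zero    g h = refl
tabulate-splitAt (suc e) g h = cong (g zero ∷_) (trans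
  (tabulate-cong (λ i → [,]-map (splitAt e i)))
  (tabulate-splitAt e (g ∘ suc) h))

det-cong : ∀ {n} {A B : Fin n → Fin n → ℤ} → (∀ i j → A i j ≡ B i j) → det A ≡ det B
det-cong {zero}  e = refl
det-cong {suc n} e = sum-cong (λ j → cong (-1ℤ ^′ toℕ j *_) (cong₂ _*_ (e zero j) (det-cong (λ r s → e (suc r) (punchIn j s)))))

det-sylvester : ∀ d e p q → det (sylvester d e p q) ≡ Res d e (coeff p) (coeff q)
det-sylvester d e p q = begin
  det (sylvester d e p q)            ≡⟨ det-cong (λ i j → entry j (splitAt e i)) ⟩
  det (λ i → entries (row (splitAt e i)))  ≡⟨ Det-det (e ℕ.+ d) (λ i → row (splitAt e i)) ⟨
  Det (e ℕ.+ d) (tabulate (λ i → row (splitAt e i)))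
    ≡⟨ cong (Det (e ℕ.+ d)) (tabulate-splitAt e _ _) ⟩
  Det (e ℕ.+ d) (tabulate {n = e} (λ r → x^ toℕ (opposite r) ∙ coeff p) ++ tabulate {n = d} (λ r → x^ toℕ (opposite r) ∙ coeff q))
    ≡⟨ cong (Det (e ℕ.+ d)) (cong₂ _++_ (tabulate-block e (coeff p)) (tabulate-block d (coeff q))) ⟩
  Res d e (coeff p) (coeff q) ∎
  where
  row = [ (λ (r : Fin e) → x^ toℕ (opposite r) ∙ coeff p) , (λ (r : Fin d) → x^ toℕ (opposite r) ∙ coeff q) ]′
  entry : ∀ (j : Fin (e ℕ.+ d)) s →
    coeff ([ (λ (r : Fin e) → shift (toℕ (opposite r)) p) , (λ (r : Fin d) → shift (toℕ (opposite r)) q) ]′ s) (toℕ (opposite j)) ≡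
    entries (row s) j
  entry j (inj₁ r) = coeff-shift (toℕ (opposite r)) p (toℕ (opposite j))
  entry j (inj₂ r) = coeff-shift (toℕ (opposite r)) q (toℕ (opposite j))

Det-size : ∀ {m n} → m ≡ n → ∀ us → Det m us ≡ Det n us
Det-size refl us = refl

-- Exchange of the arguments and lowering of formal degrees

Res-swap : ∀ d e p q → Res d e p q ≡ -1ℤ ^ (e ℕ.* d) * Res e d q p
Res-swap d e p q = begin
  Det (e ℕ.+ d) (block e p ++ block d q)
    ≡⟨ cong (λ us → Det (e ℕ.+ d) (block e p ++ us)) (++-identityʳ (block d q)) ⟨
  Det (e ℕ.+ d) (block e p ++ block d q ++ [])
    ≡⟨ swap-blocks (Det-alternating (e ℕ.+ d)) (block e p) (block d q) [] ⟩
  -1ℤ ^ (length (block e p) ℕ.* length (block d q)) * Det (e ℕ.+ d) (block d q ++ block e p ++ [])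
    ≡⟨ cong₂ (λ l us → -1ℤ ^ l * Det (e ℕ.+ d) (block d q ++ us))
         (cong₂ ℕ._*_ (length-block e p) (length-block d q)) (++-identityʳ (block e p)) ⟩
  -1ℤ ^ (e ℕ.* d) * Det (e ℕ.+ d) (block d q ++ block e p)
    ≡⟨ cong (-1ℤ ^ (e ℕ.* d) *_) (Det-size (ℕ.+-comm e d) (block d q ++ block e p)) ⟩
  -1ℤ ^ (e ℕ.* d) * Res e d q p ∎

Res-cong : ∀ d e {p p′ q q′} → p ≗ p′ → q ≗ q′ → Res d e p q ≡ Res d e p′ q′
Res-cong d e e₁ e₂ = Det-alternating (e ℕ.+ d) .cong-≋
  (Pointwise.++⁺ (block-Pointwise e _ _ (λ j _ → x^-cong j e₁)) (block-Pointwise d _ _ (λ j _ → x^-cong j e₂)))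

block-below : ∀ j {n p} → Below (suc n) p → All (Below (j ℕ.+ n)) (block j p)
block-below j {n} {p} b = block-All j p (λ i i<j →
  below-≤ (subst (_≤ j ℕ.+ n) (sym (ℕ.+-suc i n)) (ℕ.+-monoˡ-≤ n i<j)) (below-x^ i b))

-- A staircase: the row `x^ j ∙ u` reaches index `j + n`, where every later row vanishes, so it only
-- contributes the factor `u n`.
Det-strip-block : ∀ j n u {vs} → Below (suc n) u → All (Below n) vs →
                  Det (j ℕ.+ n) (block j u ++ vs) ≡ u n ^ j * Det n vs
Det-strip-block zero    n u b bs = sym (*-identityˡ _)
Det-strip-block (suc j) n u {vs} b bs = begin
  Det (suc j ℕ.+ n) (x^ j ∙ u ∷ block j u ++ vs)
    ≡⟨ Det-strip (j ℕ.+ n) (x^ j ∙ u) (all-below-coeff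
         (All-++⁺ (block-below j b) (All.map (below-≤ (ℕ.m≤n+m n j)) bs))) ⟩
  (x^ j ∙ u) (j ℕ.+ n) * Det (j ℕ.+ n) (block j u ++ vs)
    ≡⟨ cong₂ _*_ (x^-coeff j u n) (Det-strip-block j n u b bs) ⟩
  u n * (u n ^ j * Det n vs)
    ≡⟨ *-assoc (u n) (u n ^ j) (Det n vs) ⟨
  u n ^ suc j * Det n vs ∎

-- When `q` has smaller degree than its formal degree, the highest `j` rows of `p` are a staircase
-- over a smaller Sylvester matrix.
Res-strip : ∀ j k d p q → Below (suc k) p → Below (suc d) q →
            Res k (j ℕ.+ d) p q ≡ p k ^ j * Res k d p q
Res-strip j k d p q bp bq = begin
  Det (j ℕ.+ d ℕ.+ k) (block (j ℕ.+ d) p ++ block k q)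
    ≡⟨ cong₂ Det (ℕ.+-assoc j d k) (trans (cong (_++ block k q) (block-++ j d p)) (++-assoc (block j (x^ d ∙ p)) _ _)) ⟩
  Det (j ℕ.+ (d ℕ.+ k)) (block j (x^ d ∙ p) ++ block d p ++ block k q)
    ≡⟨ Det-strip-block j (d ℕ.+ k) (x^ d ∙ p)
         (below-≤ (ℕ.≤-reflexive (ℕ.+-suc d k)) (below-x^ d bp))
         (All-++⁺ (block-below d bp) (subst (λ n → All (Below n) (block k q)) (ℕ.+-comm k d) (block-below k bq))) ⟩
  (x^ d ∙ p) (d ℕ.+ k) ^ j * Res k d p q
    ≡⟨ cong (λ y → y ^ j * Res k d p q) (x^-coeff d p k) ⟩
  p k ^ j * Res k d p q ∎

-- Reduction modulo a polynomial

span-map : ∀ {P P′ w} i → (∀ {u} → P u → P′ (x^ i ∙ u)) → Span P w → Span P′ (x^ i ∙ w)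
span-map i h (gen p)     = gen (h p)
span-map i h null        = cong-≗ (λ l → sym (x^-𝟘 i l)) null
span-map i h (comb x {u} {v} p q) = cong-≗ (λ l → sym (x^-comb i x u v l)) (comb x (span-map i h p) (span-map i h q))
span-map i h (cong-≗ e p) = cong-≗ (x^-cong i e) (span-map i h p)

-- These are the multiples of `q` by cofactors of degree below `d`; the bound is the number of rows
-- of `q` available in the Sylvester matrix to annihilate them.
Multiple : ℕ → Seq → Seq → Set
Multiple d q = Span (λ u → ∃ λ j → j < d × u ≡ x^ j ∙ q)

multiple-≤ : ∀ {d e q w} → d ≤ e → Multiple d q w → Multiple e q w
multiple-≤ d≤e = span-map 0 (λ where (j , j<d , e) → j , ℕ.≤-trans j<d d≤e , e)

multiple-x^ : ∀ i {d q w} → Multiple d q w → Multiple (i ℕ.+ d) q (x^ i ∙ w)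
multiple-x^ i {q = q} = span-map i (λ where
  (j , j<d , refl) → i ℕ.+ j , ℕ.+-monoʳ-< i j<d , sym (x^-+ i j q))

-- Replacing `v` by `w` keeps both formal degrees and thus the size of the matrix. The hypothesis is
-- made for each shift because the shifted cofactor must still fit into the `d` rows of `p`.
Res-reduce : ∀ k d p x v w →
  (∀ i → i < k → Multiple d p (x^ i ∙ (x ⊙ v ⊕ -1ℤ ⊙ w))) →
  x ^ k * Res k d p v ≡ Res k d p w
Res-reduce k d p x v w h = begin
  x ^ k * Res k d p v
    ≡⟨ cong (λ l → x ^ l * Res k d p v) (length-block k v) ⟨
  x ^ length (block k v) * Det (d ℕ.+ k) (block d p ++ block k v)
    ≡⟨ reduce (Multiple d p) (fix-prefix (block d p) (Det-alternating (d ℕ.+ k)))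
         (annihilates-span (fix-prefix (block d p) (Det-alternating (d ℕ.+ k)))
           (λ where (j , j<d , refl) → annihilates-∈ (block d p) (Det-alternating (d ℕ.+ k)) (∈-block p j<d)))
         x (block-Pointwise k v w (λ i i<k → cong-≗ (split i) (h i i<k))) ⟩
  Res k d p w ∎
  where
  split : ∀ i → x^ i ∙ (x ⊙ v ⊕ -1ℤ ⊙ w) ≗ (x ⊙ (x^ i ∙ v) ⊕ -1ℤ ⊙ (x^ i ∙ w))
  split i l = trans (x^-comb i x v (-1ℤ ⊙ w) l) (cong (λ y → x * (x^ i ∙ v) l + y) (x^-scale i -1ℤ w l))

Res-scale : ∀ k d p x v → Res k d p (x ⊙ v) ≡ x ^ k * Res k d p v
Res-scale k d p x v = sym (Res-reduce k d p x v (x ⊙ v) (λ i _ →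
  cong-≗ (λ l → sym (trans (x^-cong i (λ n → eq (x * v n)) l) (x^-𝟘 i l))) null))
  where
  eq : ∀ y → y + -1ℤ * y ≡ 0ℤ
  eq = solve-∀

Res-one : ∀ k p → Res k 0 p one ≡ 1ℤ
Res-one k p = Det-block-one k

sign² : ∀ n → -1ℤ ^ n * -1ℤ ^ n ≡ 1ℤ
sign² zero    = refl
sign² (suc n) = trans (eq (-1ℤ ^ n)) (sign² n)
  where
  eq : ∀ x → -1ℤ * x * (-1ℤ * x) ≡ x * x
  eq = solve-∀

span-lc : ∀ {P n} A (b : Fin n → Seq) → (∀ j → P (b j)) → Span P (lc A b)
span-lc {n = zero}  A b h = null
span-lc {n = suc n} A b h = comb (A zero) (gen (h zero)) (span-lc (A ∘ suc) (b ∘ suc) (h ∘ suc))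

multiple-one : ∀ {d w} → Below d w → Multiple d one w
multiple-one {d} b = cong-≗ (lc-entries-all d b)
  (span-lc _ (monomials d) (λ j → toℕ (opposite j) , toℕ<n (opposite j) , refl))

-- Split `p` into `p 0` and `x` times a sequence supported below `d`. The second part is a
-- combination of the `d` rows of `x` and drops out; in the first, moving `one` behind these rows
-- yields the monomials and the sign.
Res-x : ∀ d p → Below (suc d) p → Res d 1 p (x^ 1 ∙ one) ≡ -1ℤ ^ d * p 0
Res-x d p b = begin
  D (p ∷ X-block)
    ≡⟨ head-cong Δ {p} {p 0 ⊙ one ⊕ x^ 1 ∙ (p ∘ suc)} X-block (λ where zero → eq₁ (p 0) ; (suc i) → eq₂ (p 0) (p (suc i))) ⟩
  D ((p 0 ⊙ one ⊕ x^ 1 ∙ (p ∘ suc)) ∷ X-block)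
    ≡⟨ linear₁ Δ (p 0) one (x^ 1 ∙ (p ∘ suc)) X-block ⟩
  p 0 * D (one ∷ X-block) + D (x^ 1 ∙ (p ∘ suc) ∷ X-block)
    ≡⟨ cong₂ (λ y z → p 0 * y + z) at-one at-rest ⟩
  p 0 * -1ℤ ^ d + 0ℤ
    ≡⟨ trans (+-identityʳ _) (*-comm (p 0) (-1ℤ ^ d)) ⟩
  -1ℤ ^ d * p 0 ∎
  where
  D = Det (suc d)
  Δ = Det-alternating (suc d)
  X-block = block d (x^ 1 ∙ one)
  eq₁ : ∀ y → y ≡ y * 1ℤ + 0ℤ
  eq₁ = solve-∀
  eq₂ : ∀ y z → z ≡ y * 0ℤ + z
  eq₂ = solve-∀
  move-last : ∀ u → D (u ∷ X-block) ≡ -1ℤ ^ d * D (X-block ++ u ∷ [])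
  move-last u = begin
    D (u ∷ X-block)          ≡⟨ cong (λ us → D (u ∷ us)) (++-identityʳ X-block) ⟨
    D (u ∷ X-block ++ [])    ≡⟨ move Δ u X-block [] ⟩
    -1ℤ ^ length X-block * D (X-block ++ u ∷ [])
      ≡⟨ cong (λ l → -1ℤ ^ l * D (X-block ++ u ∷ [])) (length-block d (x^ 1 ∙ one)) ⟩
    -1ℤ ^ d * D (X-block ++ u ∷ []) ∎
  at-one : D (one ∷ X-block) ≡ -1ℤ ^ d
  at-one = begin
    D (one ∷ X-block)                    ≡⟨ move-last one ⟩
    -1ℤ ^ d * D (X-block ++ one ∷ [])    ≡⟨ cong (λ us → -1ℤ ^ d * D us) (block-++ d 1 one) ⟨
    -1ℤ ^ d * D (block (d ℕ.+ 1) one)    ≡⟨ cong (λ n → -1ℤ ^ d * D (block n one)) (ℕ.+-comm d 1) ⟩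
    -1ℤ ^ d * D (block (suc d) one)      ≡⟨ cong (-1ℤ ^ d *_) (Det-block-one (suc d)) ⟩
    -1ℤ ^ d * 1ℤ                         ≡⟨ *-identityʳ _ ⟩
    -1ℤ ^ d                              ∎
  multiple : Multiple d (x^ 1 ∙ one) (x^ 1 ∙ (p ∘ suc))
  multiple = span-map 1 (λ where (j , j<d , refl) → j , j<d , x^-comm 1 j one)
    (multiple-one {d} (λ i d≤i → b (suc i) (s≤s d≤i)))
  at-rest : D (x^ 1 ∙ (p ∘ suc) ∷ X-block) ≡ 0ℤ
  at-rest = begin
    D (x^ 1 ∙ (p ∘ suc) ∷ X-block)      ≡⟨ move-last (x^ 1 ∙ (p ∘ suc)) ⟩
    -1ℤ ^ d * D (X-block ++ x^ 1 ∙ (p ∘ suc) ∷ [])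
      ≡⟨ cong (-1ℤ ^ d *_) (annihilates-span (fix-prefix X-block Δ)
           (λ where (j , j<d , refl) → annihilates-∈ X-block Δ (∈-block _ j<d)) multiple []) ⟩
    -1ℤ ^ d * 0ℤ                        ≡⟨ *-zeroʳ (-1ℤ ^ d) ⟩
    0ℤ                                  ∎

-- Multiplicativity in a factor x ^ k + c
binom : ℕ → ℤ → Seq → Seq
binom k c w = c ⊙ w ⊕ x^ k ∙ w

module _ (k : ℕ) (c : ℤ) where

  binom-cong : ∀ {u v} → u ≗ v → binom k c u ≗ binom k c v
  binom-cong e i = cong₂ (λ y z → c * y + z) (e i) (x^-cong k e i)

  binom-comb : ∀ x u v → binom k c (x ⊙ u ⊕ v) ≗ (x ⊙ binom k c u ⊕ binom k c v)
  binom-comb x u v i = trans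
    (cong (λ y → c * (x * u i + v i) + y) (x^-comb k x u v i))
    (eq c x (u i) (v i) ((x^ k ∙ u) i) ((x^ k ∙ v) i))
    where
    eq : ∀ c x u v y z → c * (x * u + v) + (x * y + z) ≡ x * (c * u + y) + (c * v + z)
    eq = solve-∀

  binom-x^ : ∀ j u → x^ j ∙ binom k c u ≗ binom k c (x^ j ∙ u)
  binom-x^ j u i = trans (x^-comb j c u (x^ k ∙ u) i)
    (cong (λ w → c * (x^ j ∙ u) i + w i) (x^-comm j k u))

  below-binom : ∀ {n w} → Below n w → Below (k ℕ.+ n) (binom k c w)
  below-binom {n} b = below-comb c (below-≤ (ℕ.m≤n+m n k) b) (below-x^ k b)

  map-binom-alternating : ∀ {φ} → Alternating φ → Alternating (φ ∘ map (binom k c))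
  map-binom-alternating Φ .cong-≋ e =
    Φ .cong-≋ (Pointwise.map⁺ (binom k c) (binom k c) (Pointwise.map binom-cong e))
  map-binom-alternating {φ} Φ .linear us x u v ws
    rewrite map-++ (binom k c) us ((x ⊙ u ⊕ v) ∷ ws)
          | map-++ (binom k c) us (u ∷ ws)
          | map-++ (binom k c) us (v ∷ ws) = trans
    (Φ .cong-≋ (≋-at (map (binom k c) us) (map (binom k c) ws) (binom-comb x u v)))
    (Φ .linear (map (binom k c) us) x (binom k c u) (binom k c v) (map (binom k c) ws))
  map-binom-alternating Φ .repeat us u ws
    rewrite map-++ (binom k c) us (u ∷ u ∷ ws) = Φ .repeat (map (binom k c) us) (binom k c u) (map (binom k c) ws)

  map-binom-block : ∀ e p → map (binom k c) (block e p) ≋ block e (binom k c p)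
  map-binom-block zero    p = []
  map-binom-block (suc e) p = (λ i → sym (binom-x^ e p i)) ∷ map-binom-block e p

  triangular : ∀ {φ} → Alternating φ → 1 ≤ k → ∀ e p ws →
    φ (block e (binom k c p) ++ block k p ++ ws) ≡ φ (block e (x^ k ∙ p) ++ block k p ++ ws)
  triangular Φ 1≤k zero    p ws = refl
  triangular {φ} Φ 1≤k (suc e) p ws = begin
    φ (x^ e ∙ binom k c p ∷ block e (binom k c p) ++ block k p ++ ws)
      ≡⟨ triangular (fix-head (x^ e ∙ binom k c p) Φ) 1≤k e p ws ⟩
    φ (x^ e ∙ binom k c p ∷ rest)
      ≡⟨ head-cong Φ rest (x^-comb e c p (x^ k ∙ p)) ⟩
    φ ((c ⊙ (x^ e ∙ p) ⊕ x^ e ∙ (x^ k ∙ p)) ∷ rest)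
      ≡⟨ linear₁ Φ c (x^ e ∙ p) (x^ e ∙ (x^ k ∙ p)) rest ⟩
    c * φ (x^ e ∙ p ∷ rest) + φ (x^ e ∙ (x^ k ∙ p) ∷ rest)
      ≡⟨ cong (λ y → c * y + φ (x^ e ∙ (x^ k ∙ p) ∷ rest)) repeated ⟩
    c * 0ℤ + φ (x^ e ∙ (x^ k ∙ p) ∷ rest)
      ≡⟨ trans (cong (_+ φ (x^ e ∙ (x^ k ∙ p) ∷ rest)) (*-zeroʳ c)) (+-identityˡ _) ⟩
    φ (x^ e ∙ (x^ k ∙ p) ∷ rest) ∎
    where
    rest = block e (x^ k ∙ p) ++ block k p ++ ws
    rest≡ : rest ≡ block (e ℕ.+ k) p ++ ws
    rest≡ = trans (sym (++-assoc (block e (x^ k ∙ p)) (block k p) ws)) (cong (_++ ws) (sym (block-++ e k p)))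
    e<e+k : e < e ℕ.+ k
    e<e+k = subst (_≤ e ℕ.+ k) (ℕ.+-comm e 1) (ℕ.+-monoʳ-≤ e 1≤k)
    repeated : φ (x^ e ∙ p ∷ rest) ≡ 0ℤ
    repeated = begin
      φ (x^ e ∙ p ∷ rest)                    ≡⟨ cong (λ us → φ (x^ e ∙ p ∷ us)) rest≡ ⟩
      φ (x^ e ∙ p ∷ block (e ℕ.+ k) p ++ ws) ≡⟨ move Φ (x^ e ∙ p) (block (e ℕ.+ k) p) ws ⟩
      -1ℤ ^ length (block (e ℕ.+ k) p) * φ (block (e ℕ.+ k) p ++ x^ e ∙ p ∷ ws)
        ≡⟨ cong (-1ℤ ^ length (block (e ℕ.+ k) p) *_) (annihilates-∈ (block (e ℕ.+ k) p) Φ (∈-block p e<e+k) ws) ⟩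
      -1ℤ ^ length (block (e ℕ.+ k) p) * 0ℤ  ≡⟨ *-zeroʳ (-1ℤ ^ length (block (e ℕ.+ k) p)) ⟩
      0ℤ                                     ∎

  binom-one-top : 1 ≤ k → binom k c one k ≡ 1ℤ
  binom-one-top 1≤k = begin
    c * one k + (x^ k ∙ one) k   ≡⟨ cong₂ (λ y z → c * y + z) (below-one k 1≤k) (x^-top k one) ⟩
    c * 0ℤ + 1ℤ                  ≡⟨ cong (_+ 1ℤ) (*-zeroʳ c) ⟩
    1ℤ                           ∎

  below-binom-one : Below (suc k) (binom k c one)
  below-binom-one = below-≤ (ℕ.≤-reflexive (ℕ.+-comm k 1)) (below-binom below-one)

  -- Multiplying e + d rows by x ^ k + c and putting the k rows of p in front of
  -- them is an alternating form Ψ of those rows, hence determined by its value on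
  -- the monomials. Compare its values there and on the Sylvester rows of p and q.
  Res-binom : 1 ≤ k → ∀ d e p q → Below (suc d) p → Below (suc e) q →
    Res d (e ℕ.+ k) p (binom k c q) ≡ Res d k p (binom k c one) * Res d e p q
  Res-binom 1≤k d e p q bp bq = begin
    Res d (e ℕ.+ k) p (h q)
      ≡⟨ *-identityˡ _ ⟨
    -- The sign `ε` of moving `k` rows past `e` rows occurs in both values of `Ψ`; inserting its
    -- square removes it without a division.
    1ℤ * Res d (e ℕ.+ k) p (h q)
      ≡⟨ cong (_* Res d (e ℕ.+ k) p (h q)) (sign² (k ℕ.* e)) ⟨
    ε * ε * Res d (e ℕ.+ k) p (h q)
      ≡⟨ *-assoc ε ε _ ⟩
    ε * (ε * Res d (e ℕ.+ k) p (h q))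
      ≡⟨ cong (ε *_) at-rows ⟨
    ε * Ψ (block e p ++ block d q)
      ≡⟨ cong (ε *_) (Det-unique Ψ-alt (e ℕ.+ d) (block e p ++ block d q) length-rows below-rows) ⟩
    ε * (Res d e p q * Ψ (block (e ℕ.+ d) one))
      ≡⟨ cong (λ y → ε * (Res d e p q * y)) at-one ⟩
    ε * (Res d e p q * (ε * Res d k p (h one)))
      ≡⟨ eq ε (Res d e p q) (Res d k p (h one)) ⟩
    ε * ε * (Res d k p (h one) * Res d e p q)
      ≡⟨ cong (_* (Res d k p (h one) * Res d e p q)) (sign² (k ℕ.* e)) ⟩
    1ℤ * (Res d k p (h one) * Res d e p q)
      ≡⟨ *-identityˡ _ ⟩
    Res d k p (h one) * Res d e p q ∎
    where
    h = binom k c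
    ε = -1ℤ ^ (k ℕ.* e)
    N = k ℕ.+ (e ℕ.+ d)
    D = Det N
    Δ = Det-alternating N
    eq : ∀ s x y → s * (x * (s * y)) ≡ s * s * (y * x)
    eq = solve-∀
    Ψ : List Seq → ℤ
    Ψ ws = D (block k p ++ map h ws)
    Ψ-alt : Alternating Ψ
    Ψ-alt = map-binom-alternating (fix-prefix (block k p) Δ)
    length-rows : length (block e p ++ block d q) ≡ e ℕ.+ d
    length-rows = trans (length-++ (block e p)) (cong₂ ℕ._+_ (length-block e p) (length-block d q))
    below-rows : All (Below (e ℕ.+ d)) (block e p ++ block d q)
    below-rows = All-++⁺ (block-below e bp)
      (subst (λ n → All (Below n) (block d q)) (ℕ.+-comm d e) (block-below d bq))
    swap : ∀ u vs → D (block k p ++ block e u ++ vs) ≡ ε * D (block e u ++ block k p ++ vs)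
    swap u vs = trans (swap-blocks Δ (block k p) (block e u) vs)
      (cong (λ l → -1ℤ ^ l * D (block e u ++ block k p ++ vs)) (cong₂ ℕ._*_ (length-block k p) (length-block e u)))
    at-rows : Ψ (block e p ++ block d q) ≡ ε * Res d (e ℕ.+ k) p (h q)
    at-rows = begin
      D (block k p ++ map h (block e p ++ block d q))
        ≡⟨ cong (λ us → D (block k p ++ us)) (map-++ h (block e p) (block d q)) ⟩
      D (block k p ++ map h (block e p) ++ map h (block d q))
        ≡⟨ Δ .cong-≋ (Pointwise.++⁺ (≋-refl (block k p)) (Pointwise.++⁺ (map-binom-block e p) (map-binom-block d q))) ⟩
      D (block k p ++ block e (h p) ++ block d (h q))
        ≡⟨ swap (h p) (block d (h q)) ⟩
      ε * D (block e (h p) ++ block k p ++ block d (h q))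
        ≡⟨ cong (ε *_) (triangular Δ 1≤k e p (block d (h q))) ⟩
      ε * D (block e (x^ k ∙ p) ++ block k p ++ block d (h q))
        ≡⟨ cong (λ us → ε * D us) (++-assoc (block e (x^ k ∙ p)) (block k p) (block d (h q))) ⟨
      ε * D ((block e (x^ k ∙ p) ++ block k p) ++ block d (h q))
        ≡⟨ cong (λ us → ε * D (us ++ block d (h q))) (block-++ e k p) ⟨
      ε * D (block (e ℕ.+ k) p ++ block d (h q))
        ≡⟨ cong (ε *_) (Det-size size (block (e ℕ.+ k) p ++ block d (h q))) ⟩
      ε * Res d (e ℕ.+ k) p (h q) ∎
      where
      size : N ≡ e ℕ.+ k ℕ.+ d
      size = trans (sym (ℕ.+-assoc k e d)) (cong (ℕ._+ d) (ℕ.+-comm k e))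
    at-one : Ψ (block (e ℕ.+ d) one) ≡ ε * Res d k p (h one)
    at-one = begin
      D (block k p ++ map h (block (e ℕ.+ d) one))
        ≡⟨ Δ .cong-≋ (Pointwise.++⁺ (≋-refl (block k p)) (map-binom-block (e ℕ.+ d) one)) ⟩
      D (block k p ++ block (e ℕ.+ d) (h one))
        ≡⟨ cong (λ us → D (block k p ++ us)) (block-++ e d (h one)) ⟩
      D (block k p ++ block e (x^ d ∙ h one) ++ block d (h one))
        ≡⟨ swap (x^ d ∙ h one) (block d (h one)) ⟩
      ε * D (block e (x^ d ∙ h one) ++ block k p ++ block d (h one))
        ≡⟨ cong (ε *_) (Det-size size (block e (x^ d ∙ h one) ++ block k p ++ block d (h one))) ⟩
      ε * Det (e ℕ.+ (k ℕ.+ d)) (block e (x^ d ∙ h one) ++ block k p ++ block d (h one))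
        -- The `e` highest rows are a monic staircase over the Sylvester rows of `p` and
        -- `x ^ k + c`, so stripping them costs only the factor 1.
        ≡⟨ cong (ε *_) (Det-strip-block e (k ℕ.+ d) (x^ d ∙ h one)
             (below-≤ (ℕ.≤-reflexive (trans (ℕ.+-suc d k) (cong suc (ℕ.+-comm d k)))) (below-x^ d below-binom-one))
             (All-++⁺ (block-below k bp)
               (subst (λ n → All (Below n) (block d (h one))) (ℕ.+-comm d k) (block-below d below-binom-one)))) ⟩
      ε * ((x^ d ∙ h one) (k ℕ.+ d) ^ e * Res d k p (h one))
        ≡⟨ cong (λ y → ε * (y ^ e * Res d k p (h one))) top ⟩
      ε * (1ℤ ^ e * Res d k p (h one))
        ≡⟨ cong (λ y → ε * (y * Res d k p (h one))) (^-zeroˡ e) ⟩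
      ε * (1ℤ * Res d k p (h one))
        ≡⟨ cong (ε *_) (*-identityˡ (Res d k p (h one))) ⟩
      ε * Res d k p (h one) ∎
      where
      size : N ≡ e ℕ.+ (k ℕ.+ d)
      size = trans (sym (ℕ.+-assoc k e d)) (trans (cong (ℕ._+ d) (ℕ.+-comm k e)) (ℕ.+-assoc e k d))
      top : (x^ d ∙ h one) (k ℕ.+ d) ≡ 1ℤ
      top = begin
        (x^ d ∙ h one) (k ℕ.+ d)   ≡⟨ cong (x^ d ∙ h one) (ℕ.+-comm k d) ⟩
        (x^ d ∙ h one) (d ℕ.+ k)   ≡⟨ x^-coeff d (h one) k ⟩
        h one k                    ≡⟨ binom-one-top 1≤k ⟩
        1ℤ                         ∎

-- Powers, signs and cancellation in the integers

^-distribʳ-* : ∀ n x y → (x * y) ^ n ≡ x ^ n * y ^ n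
^-distribʳ-* zero    x y = refl
^-distribʳ-* (suc n) x y = trans (cong (x * y *_) (^-distribʳ-* n x y)) (eq x y (x ^ n) (y ^ n))
  where
  eq : ∀ x y p q → x * y * (p * q) ≡ x * p * (y * q)
  eq = solve-∀

*-≢0 : ∀ {x y} → x ≢ 0ℤ → y ≢ 0ℤ → x * y ≢ 0ℤ
*-≢0 {x} x≢0 y≢0 e = [ x≢0 , y≢0 ]′ (i*j≡0⇒i≡0∨j≡0 x e)

^-≢0 : ∀ {x} n → x ≢ 0ℤ → x ^ n ≢ 0ℤ
^-≢0 {x} n x≢0 e = x≢0 (i^n≡0⇒i≡0 x n e)

neg-≢0 : ∀ {x} → x ≢ 0ℤ → - x ≢ 0ℤ
neg-≢0 x≢0 e = x≢0 (neg-injective e)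

cancelˡ : ∀ {x y z} → x ≢ 0ℤ → x * y ≡ x * z → y ≡ z
cancelˡ {x} {y} {z} x≢0 = *-cancelˡ-≡ x y z {{≢-nonZero x≢0}}

neg-^ : ∀ n x → (- x) ^ n ≡ -1ℤ ^ n * x ^ n
neg-^ n x = trans (cong (_^ n) (eq x)) (^-distribʳ-* n -1ℤ x)
  where
  eq : ∀ x → - x ≡ -1ℤ * x
  eq = solve-∀

sign-square : ∀ n → -1ℤ ^ (n ℕ.* n) ≡ -1ℤ ^ n
sign-square zero    = refl
sign-square (suc n) = begin
  -1ℤ * -1ℤ ^ (n ℕ.+ n ℕ.* suc n)
    ≡⟨ cong (-1ℤ *_) (^-distribˡ-+-* -1ℤ n (n ℕ.* suc n)) ⟩
  -1ℤ * (-1ℤ ^ n * -1ℤ ^ (n ℕ.* suc n))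
    ≡⟨ cong (λ l → -1ℤ * (-1ℤ ^ n * -1ℤ ^ l)) (ℕ.*-suc n n) ⟩
  -1ℤ * (-1ℤ ^ n * -1ℤ ^ (n ℕ.+ n ℕ.* n))
    ≡⟨ cong (λ y → -1ℤ * (-1ℤ ^ n * y)) (trans (^-distribˡ-+-* -1ℤ n (n ℕ.* n)) (cong (-1ℤ ^ n *_) (sign-square n))) ⟩
  -1ℤ * (-1ℤ ^ n * (-1ℤ ^ n * -1ℤ ^ n))
    ≡⟨ cong (λ y → -1ℤ * (-1ℤ ^ n * y)) (sign² n) ⟩
  -1ℤ * (-1ℤ ^ n * 1ℤ)
    ≡⟨ cong (-1ℤ *_) (*-identityʳ _) ⟩
  -1ℤ ^ suc n ∎

-- The subtractive Euclidean algorithm, read backwards.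
data Euclid : ℕ → ℕ → Set where
  base : Euclid 1 0
  swap : ∀ {k n} → Euclid k n → Euclid n k
  add  : ∀ {k n} → Euclid (suc k) n → Euclid (suc k) (suc k ℕ.+ n)

-- The argument `l` of `go` bounds the sum of the two numbers, which each subtraction lowers. When
-- one of them is 0, coprimality forces the other to be 1.
coprime⇒euclid : ∀ {k n} → Coprime k n → Euclid k n
coprime⇒euclid {k} {n} = go (k ℕ.+ n) k n ℕ.≤-refl
  where
  go : ∀ l k n → k ℕ.+ n ≤ l → Coprime k n → Euclid k n
  go l zero n _ c with refl ← c (n ∣0 , ∣-refl) = swap base
  go l (suc k) zero _ c with refl ← c (∣-refl , suc k ∣0) = base
  go (suc l) (suc k) (suc n) (s≤s le) c with ℕ.≤-total (suc k) (suc n)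
  ... | inj₁ k≤n with r , refl ← ℕ.m≤n⇒∃[o]m+o≡n k≤n =
    add (go l (suc k) r
      (ℕ.≤-trans (ℕ.+-monoʳ-≤ (suc k) (ℕ.m≤n+m r k)) (subst (_≤ l) (ℕ.+-suc k (k ℕ.+ r)) le))
      (λ (p , q) → c (p , ∣m∣n⇒∣m+n p q)))
  ... | inj₂ n≤k with r , refl ← ℕ.m≤n⇒∃[o]m+o≡n n≤k =
    swap (add (go l (suc n) r
      (ℕ.≤-trans (ℕ.≤-reflexive (ℕ.+-comm (suc n) r))
        (ℕ.≤-trans (ℕ.+-monoˡ-≤ (suc n) (ℕ.m≤n+m r n)) le))
      (λ (p , q) → c (∣m∣n⇒∣m+n p q , p))))

module _ (t : ℕ) where

  -- Coprime numbers are not both even, so `(1 + k) (1 + n)` is even and `1 + k + n ≡ k n` modulo 2;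
  -- then multiply by `t ≡ t t`. Induction along `Euclid` avoids the case distinction. The identity
  -- matches the sign of exchanging two binomials with the sign in their resultant.
  parity : ∀ {k n} → Euclid k n → (-1ℤ ^ (1 ℕ.+ k ℕ.+ n)) ^ t ≡ -1ℤ ^ (k ℕ.* t ℕ.* (n ℕ.* t))
  parity base = trans (^-zeroˡ t) (cong (-1ℤ ^_) (sym (ℕ.*-zeroʳ (1 ℕ.* t))))
  parity (swap {k} {n} E) = begin
    (-1ℤ ^ (1 ℕ.+ n ℕ.+ k)) ^ t        ≡⟨ cong (λ l → (-1ℤ ^ suc l) ^ t) (ℕ.+-comm n k) ⟩
    (-1ℤ ^ (1 ℕ.+ k ℕ.+ n)) ^ t        ≡⟨ parity E ⟩
    -1ℤ ^ (k ℕ.* t ℕ.* (n ℕ.* t))      ≡⟨ cong (-1ℤ ^_) (ℕ.*-comm (k ℕ.* t) (n ℕ.* t)) ⟩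
    -1ℤ ^ (n ℕ.* t ℕ.* (k ℕ.* t))      ∎
  parity (add {k′} {n} E) = begin
    (-1ℤ ^ (1 ℕ.+ k ℕ.+ (k ℕ.+ n))) ^ t
      ≡⟨ cong (λ l → (-1ℤ ^ suc l) ^ t) (trans (cong (k ℕ.+_) (ℕ.+-comm k n)) (sym (ℕ.+-assoc k n k))) ⟩
    (-1ℤ ^ (1 ℕ.+ k ℕ.+ n ℕ.+ k)) ^ t
      ≡⟨ cong (_^ t) (^-distribˡ-+-* -1ℤ (1 ℕ.+ k ℕ.+ n) k) ⟩
    (-1ℤ ^ (1 ℕ.+ k ℕ.+ n) * -1ℤ ^ k) ^ t
      ≡⟨ ^-distribʳ-* t (-1ℤ ^ (1 ℕ.+ k ℕ.+ n)) (-1ℤ ^ k) ⟩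
    (-1ℤ ^ (1 ℕ.+ k ℕ.+ n)) ^ t * (-1ℤ ^ k) ^ t
      ≡⟨ cong₂ _*_ (parity E) (trans (^-*-assoc -1ℤ k t) (sym (sign-square (k ℕ.* t)))) ⟩
    -1ℤ ^ (k ℕ.* t ℕ.* (n ℕ.* t)) * -1ℤ ^ (k ℕ.* t ℕ.* (k ℕ.* t))
      ≡⟨ ^-distribˡ-+-* -1ℤ (k ℕ.* t ℕ.* (n ℕ.* t)) (k ℕ.* t ℕ.* (k ℕ.* t)) ⟨
    -1ℤ ^ (k ℕ.* t ℕ.* (n ℕ.* t) ℕ.+ k ℕ.* t ℕ.* (k ℕ.* t))
      ≡⟨ cong (-1ℤ ^_) (trans (sym (ℕ.*-distribˡ-+ (k ℕ.* t) (n ℕ.* t) (k ℕ.* t)))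
           (cong (k ℕ.* t ℕ.*_) (trans (ℕ.+-comm (n ℕ.* t) (k ℕ.* t)) (sym (ℕ.*-distribʳ-+ t k n))))) ⟩
    -1ℤ ^ (k ℕ.* t ℕ.* ((k ℕ.+ n) ℕ.* t)) ∎
    where k = suc k′

-- Resultants of two binomials

binomial : ℕ → ℤ → ℤ → Seq
binomial k b d = b ⊙ (x^ k ∙ one) ⊕ d ⊙ one

below-binomial : ∀ k b d → Below (suc k) (binomial k b d)
below-binomial k b d = below-comb b
  (below-≤ (ℕ.≤-reflexive (ℕ.+-comm k 1)) (below-x^ k below-one))
  (below-scale d (below-≤ (s≤s z≤n) below-one))

binomial-top : ∀ {k} b d → 1 ≤ k → binomial k b d k ≡ b
binomial-top {k} b d 1≤k = trans
  (cong₂ (λ y z → b * y + d * z) (x^-top k one) (below-one k 1≤k))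
  (eq b d)
  where
  eq : ∀ b d → b * 1ℤ + d * 0ℤ ≡ b
  eq = solve-∀

Res-binomial-strip : ∀ {k} j n b d q → 1 ≤ k → Below (suc n) q →
  Res k (j ℕ.+ n) (binomial k b d) q ≡ b ^ j * Res k n (binomial k b d) q
Res-binomial-strip {k} j n b d q 1≤k bq = trans
  (Res-strip j k n (binomial k b d) q (below-binomial k b d) bq)
  (cong (λ y → y ^ j * Res k n (binomial k b d) q) (binomial-top b d 1≤k))

Res-const : ∀ {k} n b d g → 1 ≤ k → Res k n (binomial k b d) (g ⊙ one) ≡ g ^ k * b ^ n
Res-const {k} n b d g 1≤k = begin
  Res k n (binomial k b d) (g ⊙ one)               ≡⟨ Res-scale k n (binomial k b d) g one ⟩
  g ^ k * Res k n (binomial k b d) one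
    ≡⟨ cong (λ l → g ^ k * Res k l (binomial k b d) one) (ℕ.+-identityʳ n) ⟨
  g ^ k * Res k (n ℕ.+ 0) (binomial k b d) one
    ≡⟨ cong (g ^ k *_) (Res-binomial-strip n 0 b d one 1≤k below-one) ⟩
  g ^ k * (b ^ n * Res k 0 (binomial k b d) one)
    ≡⟨ cong (λ y → g ^ k * (b ^ n * y)) (Res-one k (binomial k b d)) ⟩
  g ^ k * (b ^ n * 1ℤ)                             ≡⟨ cong (g ^ k *_) (*-identityʳ (b ^ n)) ⟩
  g ^ k * b ^ n ∎

-- b p - a x ^ n q = b g - a d x ^ n  for  q = b x ^ k + d  and  p = a x ^ (k + n) + g
Res-euclid : ∀ {k} n b d a g → 1 ≤ k → b ≢ 0ℤ →
  Res k (k ℕ.+ n) (binomial k b d) (binomial (k ℕ.+ n) a g) ≡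
  Res k n (binomial k b d) (binomial n (- (a * d)) (b * g))
Res-euclid {k} n b d a g 1≤k b≢0 = cancelˡ (^-≢0 k b≢0) (begin
  b ^ k * Res k (k ℕ.+ n) q (binomial (k ℕ.+ n) a g)
    ≡⟨ Res-reduce k (k ℕ.+ n) q b (binomial (k ℕ.+ n) a g) r (λ i i<k →
         cong-≗ (λ l → sym (x^-cong i difference l))
           (span-map {P = _≡ x^ n ∙ q} i (λ where refl → i ℕ.+ n , ℕ.+-monoˡ-< n i<k , sym (x^-+ i n q))
             (comb a (gen refl) null))) ⟩
  Res k (k ℕ.+ n) q r
    ≡⟨ Res-binomial-strip k n b d r 1≤k (below-binomial n (- (a * d)) (b * g)) ⟩
  b ^ k * Res k n q r ∎)
  where
  q = binomial k b d
  r = binomial n (- (a * d)) (b * g)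
  x^nq : ∀ i → (x^ n ∙ q) i ≡ b * (x^ (k ℕ.+ n) ∙ one) i + d * (x^ n ∙ one) i
  x^nq i = begin
    (x^ n ∙ q) i
      ≡⟨ x^-comb n b (x^ k ∙ one) (d ⊙ one) i ⟩
    b * (x^ n ∙ (x^ k ∙ one)) i + (x^ n ∙ (d ⊙ one)) i
      ≡⟨ cong₂ (λ w y → b * w i + y) (trans (x^-comm n k one) (sym (x^-+ k n one))) (x^-scale n d one i) ⟩
    b * (x^ (k ℕ.+ n) ∙ one) i + d * (x^ n ∙ one) i ∎
  eq : ∀ b a d g y z o → b * (a * y + g * o) + -1ℤ * (- (a * d) * z + b * g * o) ≡ a * (b * y + d * z) + 0ℤ
  eq = solve-∀
  difference : (b ⊙ binomial (k ℕ.+ n) a g ⊕ -1ℤ ⊙ r) ≗ (a ⊙ (x^ n ∙ q) ⊕ 𝟘)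
  difference i = trans (eq b a d g ((x^ (k ℕ.+ n) ∙ one) i) ((x^ n ∙ one) i) (one i))
    (cong (λ y → a * y + 0ℤ) (sym (x^nq i)))

module _ (t : ℕ) (1≤t : 1 ≤ t) where

  -- Origin of the bracket: with `y = x ^ t`, a common root has `y ^ (k n)` equal to both
  -- `(- d / b) ^ n` and `(- g / a) ^ k`; clear denominators. All four coefficients are kept nonzero
  -- because `Res-euclid` cancels a power of `b` and produces the leading coefficient `- (a * d)`,
  -- while `swap` exchanges the roles of the binomials.
  Res-binomials : ∀ {k n} → Euclid k n → ∀ b d a g → b ≢ 0ℤ → d ≢ 0ℤ → a ≢ 0ℤ → g ≢ 0ℤ →
    Res (k ℕ.* t) (n ℕ.* t) (binomial (k ℕ.* t) b d) (binomial (n ℕ.* t) a g) ≡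
    (g ^ k * b ^ n + -1ℤ ^ (1 ℕ.+ k ℕ.+ n) * (a ^ k * d ^ n)) ^ t
  Res-binomials base b d a g _ _ _ _ = begin
    Res (1 ℕ.* t) 0 q (binomial 0 a g)
      ≡⟨ Res-cong (1 ℕ.* t) 0 {q} (λ _ → refl) (λ i → eq a g (one i)) ⟩
    Res (1 ℕ.* t) 0 q ((g + a) ⊙ one)
      ≡⟨ Res-scale (1 ℕ.* t) 0 q (g + a) one ⟩
    (g + a) ^ (1 ℕ.* t) * Res (1 ℕ.* t) 0 q one
      ≡⟨ cong₂ (λ l y → (g + a) ^ l * y) (ℕ.*-identityˡ t) (Res-one (1 ℕ.* t) q) ⟩
    (g + a) ^ t * 1ℤ
      ≡⟨ *-identityʳ _ ⟩
    (g + a) ^ t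
      ≡⟨ cong (_^ t) (eq₂ a g) ⟩
    (g * 1ℤ * 1ℤ + 1ℤ * (a * 1ℤ * 1ℤ)) ^ t ∎
    where
    q = binomial (1 ℕ.* t) b d
    eq : ∀ a g o → a * o + g * o ≡ (g + a) * o
    eq = solve-∀
    eq₂ : ∀ a g → g + a ≡ g * 1ℤ * 1ℤ + 1ℤ * (a * 1ℤ * 1ℤ)
    eq₂ = solve-∀
  Res-binomials (swap {k} {n} E) b d a g b≢0 d≢0 a≢0 g≢0 = begin
    Res (n ℕ.* t) (k ℕ.* t) (binomial (n ℕ.* t) b d) (binomial (k ℕ.* t) a g)
      ≡⟨ Res-swap (n ℕ.* t) (k ℕ.* t) (binomial (n ℕ.* t) b d) (binomial (k ℕ.* t) a g) ⟩
    -1ℤ ^ (k ℕ.* t ℕ.* (n ℕ.* t)) * Res (k ℕ.* t) (n ℕ.* t) (binomial (k ℕ.* t) a g) (binomial (n ℕ.* t) b d)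
      ≡⟨ cong₂ _*_ (sym (parity t E)) (Res-binomials E a g b d a≢0 g≢0 b≢0 d≢0) ⟩
    s ^ t * (d ^ k * a ^ n + s * (b ^ k * g ^ n)) ^ t
      ≡⟨ ^-distribʳ-* t s (d ^ k * a ^ n + s * (b ^ k * g ^ n)) ⟨
    (s * (d ^ k * a ^ n + s * (b ^ k * g ^ n))) ^ t
      ≡⟨ cong (_^ t) (eq s (d ^ k) (a ^ n) (b ^ k) (g ^ n)) ⟩
    (s * s * (g ^ n * b ^ k) + s * (a ^ n * d ^ k)) ^ t
      ≡⟨ cong₂ (λ y l → (y * (g ^ n * b ^ k) + -1ℤ ^ suc l * (a ^ n * d ^ k)) ^ t) (sign² (1 ℕ.+ k ℕ.+ n)) (ℕ.+-comm k n) ⟩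
    (1ℤ * (g ^ n * b ^ k) + -1ℤ ^ (1 ℕ.+ n ℕ.+ k) * (a ^ n * d ^ k)) ^ t
      ≡⟨ cong (λ y → (y + -1ℤ ^ (1 ℕ.+ n ℕ.+ k) * (a ^ n * d ^ k)) ^ t) (*-identityˡ (g ^ n * b ^ k)) ⟩
    (g ^ n * b ^ k + -1ℤ ^ (1 ℕ.+ n ℕ.+ k) * (a ^ n * d ^ k)) ^ t ∎
    where
    s = -1ℤ ^ (1 ℕ.+ k ℕ.+ n)
    eq : ∀ s d a b g → s * (d * a + s * (b * g)) ≡ s * s * (g * b) + s * (a * d)
    eq = solve-∀
  Res-binomials (add {k′} {n} E) b d a g b≢0 d≢0 a≢0 g≢0 = begin
    Res (k ℕ.* t) ((k ℕ.+ n) ℕ.* t) q (binomial ((k ℕ.+ n) ℕ.* t) a g)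
      ≡⟨ cong (λ l → Res (k ℕ.* t) l q (binomial l a g)) (ℕ.*-distribʳ-+ t k n) ⟩
    Res (k ℕ.* t) (k ℕ.* t ℕ.+ n ℕ.* t) q (binomial (k ℕ.* t ℕ.+ n ℕ.* t) a g)
      ≡⟨ Res-euclid (n ℕ.* t) b d a g (ℕ.≤-trans 1≤t (ℕ.m≤m+n t (k′ ℕ.* t))) b≢0 ⟩
    Res (k ℕ.* t) (n ℕ.* t) q (binomial (n ℕ.* t) (- (a * d)) (b * g))
      ≡⟨ Res-binomials E b d (- (a * d)) (b * g) b≢0 d≢0 (neg-≢0 (*-≢0 a≢0 d≢0)) (*-≢0 b≢0 g≢0) ⟩
    ((b * g) ^ k * b ^ n + s * ((- (a * d)) ^ k * d ^ n)) ^ t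
      ≡⟨ cong (_^ t) (cong₂ (λ y z → y * b ^ n + s * (z * d ^ n)) (^-distribʳ-* k b g)
           (trans (neg-^ k (a * d)) (cong (-1ℤ ^ k *_) (^-distribʳ-* k a d)))) ⟩
    (b ^ k * g ^ k * b ^ n + s * (-1ℤ ^ k * (a ^ k * d ^ k) * d ^ n)) ^ t
      ≡⟨ cong (_^ t) (eq (b ^ k) (g ^ k) (b ^ n) s (-1ℤ ^ k) (a ^ k) (d ^ k) (d ^ n)) ⟩
    (g ^ k * (b ^ k * b ^ n) + s * -1ℤ ^ k * (a ^ k * (d ^ k * d ^ n))) ^ t
      ≡⟨ cong (_^ t) (cong₂ (λ y z → g ^ k * y + s * -1ℤ ^ k * (a ^ k * z)) (sym (^-distribˡ-+-* b k n)) (sym (^-distribˡ-+-* d k n))) ⟩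
    (g ^ k * b ^ (k ℕ.+ n) + s * -1ℤ ^ k * (a ^ k * d ^ (k ℕ.+ n))) ^ t
      ≡⟨ cong (λ y → (g ^ k * b ^ (k ℕ.+ n) + y * (a ^ k * d ^ (k ℕ.+ n))) ^ t)
           (trans (sym (^-distribˡ-+-* -1ℤ (1 ℕ.+ k ℕ.+ n) k))
             (cong (λ l → -1ℤ ^ suc l) (trans (ℕ.+-assoc k n k) (cong (k ℕ.+_) (ℕ.+-comm n k))))) ⟩
    (g ^ k * b ^ (k ℕ.+ n) + -1ℤ ^ (1 ℕ.+ k ℕ.+ (k ℕ.+ n)) * (a ^ k * d ^ (k ℕ.+ n))) ^ t ∎
    where
    k = suc k′
    q = binomial (k ℕ.* t) b d
    s = -1ℤ ^ (1 ℕ.+ k ℕ.+ n)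
    eq : ∀ p g b s e a d f → p * g * b + s * (e * (a * d) * f) ≡ g * (p * b) + s * e * (a * (d * f))
    eq = solve-∀

-- Coefficients of polynomial expressions

-- Multiplication by `p` as an operator on sequences: it follows the recursion of `_*ᴾ_` but frees
-- the second factor from its list representation.
act : Poly → Seq → Seq
act []      w = 𝟘
act (x ∷ p) w = x ⊙ w ⊕ x^ 1 ∙ act p w

coeff-+ : ∀ p q → coeff (p +ᴾ q) ≗ (coeff p ⊕ coeff q)
coeff-+ []      q       i       = sym (+-identityˡ _)
coeff-+ (x ∷ p) []      i       = sym (+-identityʳ _)
coeff-+ (x ∷ p) (y ∷ q) zero    = refl
coeff-+ (x ∷ p) (y ∷ q) (suc i) = coeff-+ p q i

coeff-map : ∀ g → g 0ℤ ≡ 0ℤ → ∀ p → coeff (map g p) ≗ g ∘ coeff p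
coeff-map g e []      i       = sym e
coeff-map g e (x ∷ p) zero    = refl
coeff-map g e (x ∷ p) (suc i) = coeff-map g e p i

coeff-* : ∀ p q → coeff (p *ᴾ q) ≗ act p (coeff q)
coeff-* []      q i = refl
coeff-* (x ∷ p) q i = trans (coeff-+ (map (x *_) q) (0ℤ ∷ p *ᴾ q) i)
  (cong₂ _+_ (coeff-map (x *_) (*-zeroʳ x) q i) (tail i))
  where
  tail : coeff (0ℤ ∷ p *ᴾ q) ≗ x^ 1 ∙ act p (coeff q)
  tail zero    = refl
  tail (suc i) = coeff-* p q i

-- Lists with equal coefficients may differ by trailing zeros, hence the mixed cases. `act-X^`
-- relies on this, since `X *ᴾ p` is not literally `0ℤ ∷ p`.
act-congˡ : ∀ p q → coeff p ≗ coeff q → ∀ w → act p w ≗ act q w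
act-congˡ []      []      e w i = refl
act-congˡ []      (y ∷ q) e w i = sym (trans
  (cong₂ (λ z v → z * w i + v) (sym (e 0)) (x^-cong 1 (λ l → sym (act-congˡ [] q (e ∘ suc) w l)) i))
  (trans (cong (_+ (x^ 1 ∙ 𝟘) i) (*-zeroˡ (w i))) (trans (+-identityˡ _) (x^-𝟘 1 i))))
act-congˡ (x ∷ p) []      e w i = trans
  (cong₂ (λ z v → z * w i + v) (e 0) (x^-cong 1 (act-congˡ p [] (e ∘ suc) w) i))
  (trans (cong (_+ (x^ 1 ∙ 𝟘) i) (*-zeroˡ (w i))) (trans (+-identityˡ _) (x^-𝟘 1 i)))
act-congˡ (x ∷ p) (y ∷ q) e w i =
  cong₂ (λ z v → z * w i + v) (e 0) (x^-cong 1 (act-congˡ p q (e ∘ suc) w) i)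

act-congʳ : ∀ p {u v} → u ≗ v → act p u ≗ act p v
act-congʳ []      e i = refl
act-congʳ (x ∷ p) e i = cong₂ (λ y z → x * y + z) (e i) (x^-cong 1 (act-congʳ p e) i)

act-+ : ∀ p q w → act (p +ᴾ q) w ≗ (act p w ⊕ act q w)
act-+ []      q       w i       = sym (+-identityˡ _)
act-+ (x ∷ p) []      w i       = sym (+-identityʳ _)
act-+ (x ∷ p) (y ∷ q) w zero    = eq x y (w 0)
  where
  eq : ∀ x y w → (x + y) * w + 0ℤ ≡ (x * w + 0ℤ) + (y * w + 0ℤ)
  eq = solve-∀
act-+ (x ∷ p) (y ∷ q) w (suc i) = trans (cong (λ z → (x + y) * w (suc i) + z) (act-+ p q w i))
  (eq x y (w (suc i)) (act p w i) (act q w i))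
  where
  eq : ∀ x y w u v → (x + y) * w + (u + v) ≡ (x * w + u) + (y * w + v)
  eq = solve-∀

act-const : ∀ c w → act (const c) w ≗ c ⊙ w
act-const c w i = trans (cong (λ z → c * w i + z) (x^-𝟘 1 i)) (+-identityʳ _)

coeff-X* : ∀ p → coeff (X *ᴾ p) ≗ x^ 1 ∙ coeff p
coeff-X* p i = begin
  coeff (X *ᴾ p) i                         ≡⟨ coeff-* X p i ⟩
  0ℤ * coeff p i + (x^ 1 ∙ act (const 1ℤ) (coeff p)) i
    ≡⟨ cong₂ _+_ (*-zeroˡ (coeff p i)) (x^-cong 1 (λ l → trans (act-const 1ℤ (coeff p) l) (*-identityˡ _)) i) ⟩
  0ℤ + (x^ 1 ∙ coeff p) i                  ≡⟨ +-identityˡ _ ⟩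
  (x^ 1 ∙ coeff p) i                       ∎

coeff-1 : coeff (const 1ℤ) ≗ one
coeff-1 zero    = refl
coeff-1 (suc i) = refl

coeff-X^ : ∀ k → coeff (X ^ᴾ k) ≗ x^ k ∙ one
coeff-X^ zero    = coeff-1
coeff-X^ (suc k) i = trans (coeff-X* (X ^ᴾ k) i) (x^-cong 1 (coeff-X^ k) i)

act-X^ : ∀ k w → act (X ^ᴾ k) w ≗ x^ k ∙ w
act-X^ zero    w i = trans (act-const 1ℤ w i) (*-identityˡ (w i))
act-X^ (suc k) w i = begin
  act (X *ᴾ X ^ᴾ k) w i              ≡⟨ act-congˡ (X *ᴾ X ^ᴾ k) (0ℤ ∷ X ^ᴾ k) head w i ⟩
  0ℤ * w i + (x^ 1 ∙ act (X ^ᴾ k) w) i ≡⟨ cong₂ _+_ (*-zeroˡ (w i)) (x^-cong 1 (act-X^ k w) i) ⟩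
  0ℤ + (x^ suc k ∙ w) i              ≡⟨ +-identityˡ _ ⟩
  (x^ suc k ∙ w) i                   ∎
  where
  head : coeff (X *ᴾ X ^ᴾ k) ≗ coeff (0ℤ ∷ X ^ᴾ k)
  head zero    = coeff-X* (X ^ᴾ k) zero
  head (suc i) = coeff-X* (X ^ᴾ k) (suc i)

act-X^+c : ∀ k c w → act (X ^ᴾ k +ᴾ const c) w ≗ binom k c w
act-X^+c k c w i = begin
  act (X ^ᴾ k +ᴾ const c) w i               ≡⟨ act-+ (X ^ᴾ k) (const c) w i ⟩
  act (X ^ᴾ k) w i + act (const c) w i      ≡⟨ cong₂ _+_ (act-X^ k w i) (act-const c w i) ⟩
  (x^ k ∙ w) i + c * w i                    ≡⟨ ℤ.+-comm ((x^ k ∙ w) i) (c * w i) ⟩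
  binom k c w i                             ∎

-- Powers of the factor `x ^ k + c`

module _ (k : ℕ) (c : ℤ) where

  binom^ : ℕ → Seq → Seq
  binom^ zero    w = w
  binom^ (suc m) w = binom k c (binom^ m w)

  binom^-comb : ∀ m x u v → binom^ m (x ⊙ u ⊕ v) ≗ (x ⊙ binom^ m u ⊕ binom^ m v)
  binom^-comb zero    x u v i = refl
  binom^-comb (suc m) x u v i = trans (binom-cong k c (binom^-comb m x u v) i) (binom-comb k c x (binom^ m u) (binom^ m v) i)

  binom^-scale : ∀ m x u → binom^ m (x ⊙ u) ≗ x ⊙ binom^ m u
  binom^-scale zero    x u i = refl
  binom^-scale (suc m) x u i = trans
    (binom-cong k c (binom^-scale m x u) i)
    (trans (cong (λ y → c * (x * binom^ m u i) + y) (x^-scale k x (binom^ m u) i))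
           (eq c x (binom^ m u i) ((x^ k ∙ binom^ m u) i)))
    where
    eq : ∀ c x u y → c * (x * u) + x * y ≡ x * (c * u + y)
    eq = solve-∀

  binom^-binom : ∀ m w → binom^ m (binom k c w) ≡ binom k c (binom^ m w)
  binom^-binom zero    w = refl
  binom^-binom (suc m) w = cong (binom k c) (binom^-binom m w)

  binom^-x^ : ∀ m j w → x^ j ∙ binom^ m w ≗ binom^ m (x^ j ∙ w)
  binom^-x^ zero    j w i = refl
  binom^-x^ (suc m) j w i = trans (binom-x^ k c j (binom^ m w) i) (binom-cong k c (binom^-x^ m j w) i)

  below-binom^ : ∀ m {n w} → Below n w → Below (m ℕ.* k ℕ.+ n) (binom^ m w)
  below-binom^ zero    b = b
  below-binom^ (suc m) {n} b =
    below-≤ (ℕ.≤-reflexive (sym (ℕ.+-assoc k (m ℕ.* k) n))) (below-binom k c (below-binom^ m b))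

  binom^-top : 1 ≤ k → ∀ m → binom^ m one (m ℕ.* k) ≡ 1ℤ
  binom^-top 1≤k zero    = refl
  binom^-top 1≤k (suc m) = begin
    c * binom^ m one (k ℕ.+ m ℕ.* k) + (x^ k ∙ binom^ m one) (k ℕ.+ m ℕ.* k)
      ≡⟨ cong₂ (λ y z → c * y + z)
           (below-binom^ m below-one (k ℕ.+ m ℕ.* k)
             (subst (_≤ k ℕ.+ m ℕ.* k) (ℕ.+-comm 1 (m ℕ.* k)) (ℕ.+-monoˡ-≤ (m ℕ.* k) 1≤k)))
           (trans (x^-coeff k (binom^ m one) (m ℕ.* k)) (binom^-top 1≤k m)) ⟩
    c * 0ℤ + 1ℤ    ≡⟨ cong (_+ 1ℤ) (*-zeroʳ c) ⟩
    1ℤ             ∎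

  binom^-bottom : 1 ≤ k → ∀ m → binom^ m one 0 ≡ c ^ m
  binom^-bottom 1≤k zero    = refl
  binom^-bottom 1≤k (suc m) = begin
    c * binom^ m one 0 + (x^ k ∙ binom^ m one) 0
      ≡⟨ cong₂ (λ y z → c * y + z) (binom^-bottom 1≤k m) (x^-coeff-< k (binom^ m one) 1≤k) ⟩
    c * c ^ m + 0ℤ   ≡⟨ +-identityʳ _ ⟩
    c ^ suc m        ∎

  coeff-^ : ∀ m → coeff ((X ^ᴾ k +ᴾ const c) ^ᴾ m) ≗ binom^ m one
  coeff-^ zero      = coeff-1
  coeff-^ (suc m) i = begin
    coeff (p *ᴾ p ^ᴾ m) i        ≡⟨ coeff-* p (p ^ᴾ m) i ⟩
    act p (coeff (p ^ᴾ m)) i     ≡⟨ act-congʳ p (coeff-^ m) i ⟩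
    act p (binom^ m one) i       ≡⟨ act-X^+c k c (binom^ m one) i ⟩
    binom k c (binom^ m one) i   ∎
    where p = X ^ᴾ k +ᴾ const c

  Res-binom^ : 1 ≤ k → ∀ d p → Below (suc d) p → ∀ m q → Below (suc k) q →
    Res d (m ℕ.* k ℕ.+ k) p (binom^ m q) ≡ Res d k p (binom k c one) ^ m * Res d k p q
  Res-binom^ 1≤k d p bp zero    q bq = sym (*-identityˡ _)
  Res-binom^ 1≤k d p bp (suc m) q bq = begin
    Res d (k ℕ.+ m ℕ.* k ℕ.+ k) p (binom^ (suc m) q)
      ≡⟨ cong (λ l → Res d (l ℕ.+ k) p (binom^ (suc m) q)) (ℕ.+-comm k (m ℕ.* k)) ⟩
    Res d (m ℕ.* k ℕ.+ k ℕ.+ k) p (binom^ (suc m) q)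
      ≡⟨ Res-binom k c 1≤k d (m ℕ.* k ℕ.+ k) p (binom^ m q) bp
           (below-≤ (ℕ.≤-reflexive (ℕ.+-suc (m ℕ.* k) k)) (below-binom^ m bq)) ⟩
    r * Res d (m ℕ.* k ℕ.+ k) p (binom^ m q)
      ≡⟨ cong (r *_) (Res-binom^ 1≤k d p bp m q bq) ⟩
    r * (r ^ m * Res d k p q)
      ≡⟨ *-assoc r (r ^ m) (Res d k p q) ⟨
    r ^ suc m * Res d k p q ∎
    where r = Res d k p (binom k c one)

  -- b (x ^ k + c) = (b x ^ k + d) + (b c - d)
  binom^-multiple : ∀ b d m → Multiple (suc (m ℕ.* k)) (binomial k b d)
    (b ^ suc m ⊙ binom^ (suc m) one ⊕ -1ℤ ⊙ ((b * c - d) ^ suc m ⊙ one))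
  binom^-multiple b d zero =
    cong-≗ (λ i → eq b c d (one i) ((x^ k ∙ one) i)) (gen (0 , s≤s z≤n , refl))
    where
    eq : ∀ b c d o x → b * x + d * o ≡ b * 1ℤ * (c * o + x) + -1ℤ * ((b * c - d) * 1ℤ * o)
    eq = solve-∀
  -- With `p = x ^ k + c` and `j = suc m`, the element is `b p (b ^ j p ^ j - κ ^ j) + κ ^ j (b p -
  -- κ)`. The first summand uses the induction hypothesis, once times `c` and once times `x ^ k`; in
  -- the second, `b p - κ` is the divisor itself.
  binom^-multiple b d (suc m) = cong-≗ value
    (comb b
      (comb c (multiple-≤ (s≤s (ℕ.m≤n+m (m ℕ.* k) k)) IH)
              (multiple-≤ (ℕ.≤-reflexive (ℕ.+-suc k (m ℕ.* k))) (multiple-x^ k IH)))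
      (comb (κ ^ suc m) (gen (0 , s≤s z≤n , refl)) null))
    where
    κ = b * c - d
    P = binom^ (suc m) one
    w = b ^ suc m ⊙ P ⊕ -1ℤ ⊙ (κ ^ suc m ⊙ one)
    IH = binom^-multiple b d m
    x^kw : ∀ i → (x^ k ∙ w) i ≡ b ^ suc m * (x^ k ∙ P) i + -1ℤ * (κ ^ suc m * (x^ k ∙ one) i)
    x^kw i = trans (x^-comb k (b ^ suc m) P (-1ℤ ⊙ (κ ^ suc m ⊙ one)) i)
      (cong (λ y → b ^ suc m * (x^ k ∙ P) i + y)
        (trans (x^-scale k -1ℤ (κ ^ suc m ⊙ one) i) (cong (-1ℤ *_) (x^-scale k (κ ^ suc m) one i))))
    eq : ∀ b c d bm km p x^p o x →
      b * (c * (bm * p + -1ℤ * (km * o)) + (bm * x^p + -1ℤ * (km * x))) + (km * (b * x + d * o) + 0ℤ) ≡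
      b * bm * (c * p + x^p) + -1ℤ * ((b * c - d) * km * o)
    eq = solve-∀
    value : (b ⊙ (c ⊙ w ⊕ x^ k ∙ w) ⊕ (κ ^ suc m ⊙ binomial k b d ⊕ 𝟘)) ≗
            (b ^ suc (suc m) ⊙ binom^ (suc (suc m)) one ⊕ -1ℤ ⊙ (κ ^ suc (suc m) ⊙ one))
    value i = trans
      (cong (λ y → b * (c * w i + y) + (κ ^ suc m * binomial k b d i + 0ℤ)) (x^kw i))
      (eq b c d (b ^ suc m) (κ ^ suc m) (P i) ((x^ k ∙ P) i) (one i) ((x^ k ∙ one) i))

coeff-f : ∀ a c k m n → coeff (f a c k m n) ≗ (- a ⊙ (x^ n ∙ one) ⊕ binom^ k c m one)
coeff-f a c k m n i = begin
  coeff (f a c k m n) i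
    ≡⟨ coeff-+ ((X ^ᴾ k +ᴾ const c) ^ᴾ m) (map -_ (const a *ᴾ X ^ᴾ n)) i ⟩
  coeff ((X ^ᴾ k +ᴾ const c) ^ᴾ m) i + coeff (map -_ (const a *ᴾ X ^ᴾ n)) i
    ≡⟨ cong₂ _+_ (coeff-^ k c m i) (coeff-map -_ refl (const a *ᴾ X ^ᴾ n) i) ⟩
  binom^ k c m one i + - coeff (const a *ᴾ X ^ᴾ n) i
    ≡⟨ cong (λ y → binom^ k c m one i + - y)
         (trans (coeff-* (const a) (X ^ᴾ n) i) (trans (act-const a (coeff (X ^ᴾ n)) i) (cong (a *_) (coeff-X^ n i)))) ⟩
  binom^ k c m one i + - (a * (x^ n ∙ one) i)
    ≡⟨ eq (binom^ k c m one i) a ((x^ n ∙ one) i) ⟩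
  - a * (x^ n ∙ one) i + binom^ k c m one i ∎
  where
  eq : ∀ p a x → p + - (a * x) ≡ - a * x + p
  eq = solve-∀

-- The Euler operator x d/dx
θ : Seq → Seq
θ w i = + i * w i

θ-x^ : ∀ k w → θ (x^ k ∙ w) ≗ (+ k ⊙ (x^ k ∙ w) ⊕ x^ k ∙ θ w)
θ-x^ zero    w i       = sym (trans (cong (_+ θ w i) (*-zeroˡ (w i))) (+-identityˡ _))
θ-x^ (suc k) w zero    = sym (trans (+-identityʳ _) (*-zeroʳ (+ suc k)))
θ-x^ (suc k) w (suc i) = trans (eq (+ i) y) (trans (cong (λ z → y + z) (θ-x^ k w i)) (eq₂ (+ k) y ((x^ k ∙ θ w) i)))
  where
  y = (x^ k ∙ w) i
  eq : ∀ l y → (1ℤ + l) * y ≡ y + l * y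
  eq = solve-∀
  eq₂ : ∀ l y z → y + (l * y + z) ≡ (1ℤ + l) * y + z
  eq₂ = solve-∀

θ-one : θ one ≗ 𝟘
θ-one zero    = refl
θ-one (suc i) = *-zeroʳ (+ suc i)

θ-monomial : ∀ n → θ (x^ n ∙ one) ≗ + n ⊙ (x^ n ∙ one)
θ-monomial n i = trans (θ-x^ n one i)
  (trans (cong (λ y → + n * (x^ n ∙ one) i + y) (trans (x^-cong n θ-one i) (x^-𝟘 n i))) (+-identityʳ _))

θ-binom : ∀ k c w → θ (binom k c w) ≗ (+ k ⊙ (x^ k ∙ w) ⊕ binom k c (θ w))
θ-binom k c w i = trans (eq (+ i) c (w i) ((x^ k ∙ w) i))
  (trans (cong (λ y → c * (+ i * w i) + y) (θ-x^ k w i)) (eq₂ c (+ i * w i) (+ k * (x^ k ∙ w) i) ((x^ k ∙ θ w) i)))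
  where
  eq : ∀ l c w x → l * (c * w + x) ≡ c * (l * w) + l * x
  eq = solve-∀
  eq₂ : ∀ c v y z → c * v + (y + z) ≡ y + (c * v + z)
  eq₂ = solve-∀

θ-binom^ : ∀ k c m → θ (binom^ k c (suc m) one) ≗ (+ suc m * + k) ⊙ binom^ k c m (x^ k ∙ one)
θ-binom^ k c zero i = trans (θ-binom k c one i) (trans
  (cong₂ (λ y z → + k * (x^ k ∙ one) i + (c * y + z)) (θ-one i) (trans (x^-cong k θ-one i) (x^-𝟘 k i)))
  (eq c (+ k) ((x^ k ∙ one) i)))
  where
  eq : ∀ c k x → k * x + (c * 0ℤ + 0ℤ) ≡ 1ℤ * k * x
  eq = solve-∀
θ-binom^ k c (suc m) i = begin
  θ (binom^ k c (suc (suc m)) one) i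
    ≡⟨ θ-binom k c (binom^ k c (suc m) one) i ⟩
  + k * (x^ k ∙ binom^ k c (suc m) one) i + binom k c (θ (binom^ k c (suc m) one)) i
    ≡⟨ cong₂ (λ y z → + k * y + z) (binom^-x^ k c (suc m) k one i)
         (trans (binom-cong k c (θ-binom^ k c m) i) (binom^-scale k c 1 (+ suc m * + k) (binom^ k c m (x^ k ∙ one)) i)) ⟩
  + k * y + + suc m * + k * y
    ≡⟨ eq (+ k) (+ suc m) y ⟩
  + suc (suc m) * + k * y ∎
  where
  y = binom^ k c (suc m) (x^ k ∙ one) i
  eq : ∀ k m y → k * y + m * k * y ≡ (1ℤ + m) * k * y
  eq = solve-∀

coeff-derivative : ∀ p → x^ 1 ∙ coeff (derivative p) ≗ θ (coeff p)
coeff-derivative p zero    = sym (*-zeroˡ (coeff p 0))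
coeff-derivative p (suc i) = go p i
  where
  eq₁ : ∀ x → x + 0ℤ ≡ 1ℤ * x
  eq₁ = solve-∀
  eq₂ : ∀ l x → x + (1ℤ + l) * x ≡ (1ℤ + (1ℤ + l)) * x
  eq₂ = solve-∀
  go : ∀ p i → coeff (derivative p) i ≡ + suc i * coeff p (suc i)
  go []      i       = sym (*-zeroʳ (+ suc i))
  go (x ∷ p) zero    = trans (coeff-+ p (0ℤ ∷ derivative p) 0) (eq₁ (coeff p 0))
  go (x ∷ p) (suc i) = trans (coeff-+ p (0ℤ ∷ derivative p) (suc i))
    (trans (cong (λ z → coeff p (suc i) + z) (go p i)) (eq₂ (+ i) (coeff p (suc i))))

degree-top : ∀ p n → Below (suc n) (coeff p) → coeff p n ≢ 0ℤ → degree p ≡ n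
degree-top []      n b top = contradiction refl top
degree-top (x ∷ p) n b top with all? (ℤ._≟ 0ℤ) p
degree-top (x ∷ p) zero    b top | yes _  = refl
degree-top (x ∷ p) (suc n) b top | yes zs = contradiction (vanish zs n) top
  where
  vanish : ∀ {p} → All (_≡ 0ℤ) p → ∀ i → coeff p i ≡ 0ℤ
  vanish []       i       = refl
  vanish (z ∷ zs) zero    = z
  vanish (z ∷ zs) (suc i) = vanish zs i
degree-top (x ∷ p) zero    b top | no ¬zs = contradiction (zeros p (λ i → b (suc i) (s≤s z≤n))) ¬zs
  where
  zeros : ∀ p → (∀ i → coeff p i ≡ 0ℤ) → All (_≡ 0ℤ) p
  zeros []      e = []
  zeros (x ∷ p) e = e 0 ∷ zeros p (e ∘ suc)
degree-top (x ∷ p) (suc n) b top | no _ =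
  cong suc (degree-top p n (λ i n<i → b (suc i) (s≤s n<i)) top)

-- The Euclidean induction works with nonzero coefficients, whereas `a` may vanish here. In that
-- case the second binomial is the constant `g`, and the term with `a ^ k` disappears because
-- `1 ≤ k`.
Res-binomials-coprime : ∀ t k n → 1 ≤ t → 1 ≤ k → Coprime k n → ∀ b d a g → b ≢ 0ℤ → d ≢ 0ℤ → g ≢ 0ℤ →
  Res (k ℕ.* t) (n ℕ.* t) (binomial (k ℕ.* t) b d) (binomial (n ℕ.* t) a g) ≡
  (g ^ k * b ^ n + -1ℤ ^ (1 ℕ.+ k ℕ.+ n) * (a ^ k * d ^ n)) ^ t
Res-binomials-coprime t (suc k′) n 1≤t 1≤k c b d a g b≢0 d≢0 g≢0 with a ℤ.≟ 0ℤ
... | no a≢0   = Res-binomials t 1≤t (coprime⇒euclid c) b d a g b≢0 d≢0 a≢0 g≢0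
... | yes refl = begin
  Res (k ℕ.* t) (n ℕ.* t) q (binomial (n ℕ.* t) 0ℤ g)
    ≡⟨ Res-cong (k ℕ.* t) (n ℕ.* t) {q} (λ _ → refl) (λ i → eq ((x^ n ℕ.* t ∙ one) i) (g * one i)) ⟩
  Res (k ℕ.* t) (n ℕ.* t) q (g ⊙ one)
    ≡⟨ Res-const (n ℕ.* t) b d g (ℕ.*-mono-≤ 1≤k 1≤t) ⟩
  g ^ (k ℕ.* t) * b ^ (n ℕ.* t)
    ≡⟨ cong₂ _*_ (sym (^-*-assoc g k t)) (sym (^-*-assoc b n t)) ⟩
  (g ^ k) ^ t * (b ^ n) ^ t
    ≡⟨ ^-distribʳ-* t (g ^ k) (b ^ n) ⟨
  (g ^ k * b ^ n) ^ t
    ≡⟨ cong (_^ t) (eq₂ (g ^ k * b ^ n) (-1ℤ ^ (1 ℕ.+ k ℕ.+ n)) (0ℤ ^ k′) (d ^ n)) ⟩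
  (g ^ k * b ^ n + -1ℤ ^ (1 ℕ.+ k ℕ.+ n) * (0ℤ ^ k * d ^ n)) ^ t ∎
  where
  k = suc k′
  q = binomial (k ℕ.* t) b d
  eq : ∀ x y → 0ℤ * x + y ≡ y
  eq = solve-∀
  eq₂ : ∀ x s o y → x ≡ x + s * (0ℤ * o * y)
  eq₂ = solve-∀

1^-^ : ∀ m k → (1ℤ ^ m) ^ k ≡ 1ℤ
1^-^ m k = trans (cong (_^ k) (^-zeroˡ m)) (^-zeroˡ k)

-- This makes `x` an instance of the factors `x ^ k + c`, so that `Res-binom` also covers
-- multiplication by `x`.
x≗binom : ∀ w → x^ 1 ∙ w ≗ binom 1 0ℤ w
x≗binom w i = sym (trans (cong (_+ (x^ 1 ∙ w) i) (*-zeroˡ (w i))) (+-identityˡ _))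

Res-x^ : ∀ k p → Below (suc k) p → ∀ n → Res k n p (x^ n ∙ one) ≡ (-1ℤ ^ k * p 0) ^ n
Res-x^ k p b zero    = Res-one k p
Res-x^ k p b (suc n) = begin
  Res k (suc n) p (x^ suc n ∙ one)
    ≡⟨ cong (λ l → Res k l p (x^ suc n ∙ one)) (ℕ.+-comm 1 n) ⟩
  Res k (n ℕ.+ 1) p (x^ suc n ∙ one)
    ≡⟨ Res-cong k (n ℕ.+ 1) {p} (λ _ → refl) (x≗binom (x^ n ∙ one)) ⟩
  Res k (n ℕ.+ 1) p (binom 1 0ℤ (x^ n ∙ one))
    ≡⟨ Res-binom 1 0ℤ ℕ.≤-refl k n p (x^ n ∙ one) b (below-≤ (ℕ.≤-reflexive (ℕ.+-comm n 1)) (below-x^ n below-one)) ⟩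
  Res k 1 p (binom 1 0ℤ one) * Res k n p (x^ n ∙ one)
    ≡⟨ cong₂ _*_ (trans (Res-cong k 1 {p} (λ _ → refl) (λ i → sym (x≗binom one i))) (Res-x k p b)) (Res-x^ k p b n) ⟩
  (-1ℤ ^ k * p 0) ^ suc n ∎

-- Reduction of `f` modulo `P` and modulo `Q`

module _ (a c : ℤ) (k m′ n : ℕ) (1≤k : 1 ≤ k) (1≤n : 1 ≤ n) (n<d : n < k ℕ.* suc m′) where

  private
    m d : ℕ
    m = suc m′
    d = k ℕ.* m

    F : Seq
    F = - a ⊙ (x^ n ∙ one) ⊕ binom^ k c m one

    d≡ : m ℕ.* k ≡ d
    d≡ = ℕ.*-comm m k

  below-F : Below (suc d) F
  below-F = below-comb (- a)
    (below-≤ (ℕ.≤-trans (ℕ.≤-reflexive (ℕ.+-comm n 1)) (ℕ.m<n⇒m<1+n n<d)) (below-x^ n below-one))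
    (below-≤ (ℕ.≤-reflexive (trans (ℕ.+-comm (m ℕ.* k) 1) (cong suc d≡))) (below-binom^ k c m below-one))

  F-top : F d ≡ 1ℤ
  F-top = begin
    - a * (x^ n ∙ one) d + binom^ k c m one d
      ≡⟨ cong₂ (λ y z → - a * y + z)
           (below-x^ n below-one d (subst (_≤ d) (ℕ.+-comm 1 n) n<d))
           (trans (cong (binom^ k c m one) (sym d≡)) (binom^-top k c 1≤k m)) ⟩
    - a * 0ℤ + 1ℤ   ≡⟨ cong (_+ 1ℤ) (*-zeroʳ (- a)) ⟩
    1ℤ              ∎

  F-bottom : F 0 ≡ c ^ m
  F-bottom = begin
    - a * (x^ n ∙ one) 0 + binom^ k c m one 0
      ≡⟨ cong₂ (λ y z → - a * y + z) (x^-coeff-< n one 1≤n) (binom^-bottom k c 1≤k m) ⟩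
    - a * 0ℤ + c ^ m   ≡⟨ trans (cong (_+ c ^ m) (*-zeroʳ (- a))) (+-identityˡ _) ⟩
    c ^ m              ∎

  -- Modulo the divisor, `b (x ^ k + c)` is the constant `b * c - e`, so `b ^ m` times `F` becomes a
  -- binomial with exponent `n`. Each of the `k` rows of `F` costs a factor `b ^ m`, and lowering
  -- the formal degree from `d` to `n` yields `b ^ (d ∸ n)`. The general divisor serves both `P` and
  -- `Q`.
  Res-F : ∀ b e → (b ^ m) ^ k * Res k d (binomial k b e) F ≡
    b ^ (d ∸ n) * Res k n (binomial k b e) (binomial n (- a * b ^ m) ((b * c - e) ^ m))
  Res-F b e = begin
    (b ^ m) ^ k * Res k d q F
      ≡⟨ Res-reduce k d q (b ^ m) F r (λ i i<k → cong-≗ (x^-cong i same)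
           (multiple-≤ (size i i<k) (multiple-x^ i (binom^-multiple k c b e m′)))) ⟩
    Res k d q r
      ≡⟨ cong (λ l → Res k l q r) (ℕ.m∸n+n≡m (ℕ.<⇒≤ n<d)) ⟨
    Res k (d ∸ n ℕ.+ n) q r
      ≡⟨ Res-binomial-strip (d ∸ n) n b e r 1≤k (below-binomial n (- a * b ^ m) ((b * c - e) ^ m)) ⟩
    b ^ (d ∸ n) * Res k n q r ∎
    where
    q = binomial k b e
    r = binomial n (- a * b ^ m) ((b * c - e) ^ m)
    -- The cofactor has degree at most `m′ * k`; shifted by less than `k`, it stays below `d`.
    size : ∀ i → i < k → i ℕ.+ suc (m′ ℕ.* k) ≤ d
    size i i<k = ℕ.≤-trans (ℕ.≤-reflexive (ℕ.+-suc i (m′ ℕ.* k)))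
      (ℕ.≤-trans (ℕ.+-monoˡ-≤ (m′ ℕ.* k) i<k) (ℕ.≤-reflexive d≡))
    eq : ∀ B a x p κ o → B * p + -1ℤ * (κ * o) ≡ B * (- a * x + p) + -1ℤ * (- a * B * x + κ * o)
    eq = solve-∀
    same : (b ^ m ⊙ binom^ k c m one ⊕ -1ℤ ⊙ ((b * c - e) ^ m ⊙ one)) ≗ (b ^ m ⊙ F ⊕ -1ℤ ⊙ r)
    same i = eq (b ^ m) a ((x^ n ∙ one) i) (binom^ k c m one i) ((b * c - e) ^ m) (one i)

  Res-F-factor : Res d k F (binom k c one) ≡ -1ℤ ^ (k ℕ.* d) * ((- a) ^ k * (-1ℤ ^ k * c) ^ n)
  Res-F-factor = begin
    Res d k F (binom k c one)
      ≡⟨ Res-cong d k {F} (λ _ → refl) (λ i → eq c (one i) ((x^ k ∙ one) i)) ⟩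
    Res d k F P
      ≡⟨ Res-swap d k F P ⟩
    -1ℤ ^ (k ℕ.* d) * Res k d P F
      ≡⟨ cong (-1ℤ ^ (k ℕ.* d) *_) reduced ⟩
    -1ℤ ^ (k ℕ.* d) * ((- a) ^ k * (-1ℤ ^ k * c) ^ n) ∎
    where
    P = binomial k 1ℤ c
    eq : ∀ c o x → c * o + x ≡ 1ℤ * x + c * o
    eq = solve-∀
    eq₂ : ∀ a x c κ o → - a * 1ℤ * x + (1ℤ * c - c) * κ * o ≡ - a * x
    eq₂ = solve-∀
    eq₃ : ∀ c → 1ℤ * 0ℤ + c * 1ℤ ≡ c
    eq₃ = solve-∀
    P-bottom : P 0 ≡ c
    P-bottom = trans (cong (λ y → 1ℤ * y + c * 1ℤ) (x^-coeff-< k one 1≤k)) (eq₃ c)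
    reduced : Res k d P F ≡ (- a) ^ k * (-1ℤ ^ k * c) ^ n
    reduced = begin
      Res k d P F
        ≡⟨ *-identityˡ (Res k d P F) ⟨
      1ℤ * Res k d P F
        ≡⟨ cong (_* Res k d P F) (1^-^ m k) ⟨
      (1ℤ ^ m) ^ k * Res k d P F
        ≡⟨ Res-F 1ℤ c ⟩
      1ℤ ^ (d ∸ n) * Res k n P (binomial n (- a * 1ℤ ^ m) ((1ℤ * c - c) ^ m))
        -- The constant term `(1ℤ * c - c) ^ m` vanishes because `m` is a successor.
        ≡⟨ cong₂ _*_ (^-zeroˡ (d ∸ n)) (Res-cong k n {P} (λ _ → refl) (λ i → trans
             (cong (λ y → - a * y * (x^ n ∙ one) i + (1ℤ * c - c) ^ m * one i) (^-zeroˡ m))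
             (eq₂ a ((x^ n ∙ one) i) c ((1ℤ * c - c) ^ m′) (one i)))) ⟩
      1ℤ * Res k n P (- a ⊙ (x^ n ∙ one))
        ≡⟨ *-identityˡ _ ⟩
      Res k n P (- a ⊙ (x^ n ∙ one))
        ≡⟨ Res-scale k n P (- a) (x^ n ∙ one) ⟩
      (- a) ^ k * Res k n P (x^ n ∙ one)
        ≡⟨ cong ((- a) ^ k *_) (Res-x^ k P (below-binomial k 1ℤ c) n) ⟩
      (- a) ^ k * (-1ℤ ^ k * P 0) ^ n
        ≡⟨ cong (λ y → (- a) ^ k * (-1ℤ ^ k * y) ^ n) P-bottom ⟩
      (- a) ^ k * (-1ℤ ^ k * c) ^ n ∎

  private
    β : ℤ
    β = + d - + n

    Q : Seq
    Q = binomial k β (- (+ n * c))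

  -- `θ` multiplies `x ^ n` by `n`, so subtracting `n F` removes the term with `a`. The rest,
  -- `d x ^ k P ^ m′ - n P ^ m`, contains `P ^ m′`, and `Q` is the cofactor.
  θ-F : θ F ≗ (+ n ⊙ F ⊕ binom^ k c m′ Q)
  θ-F i = begin
    + i * (- a * Xⁿ + binom^ k c m one i)
      ≡⟨ eq₁ (+ i) a Xⁿ (binom^ k c m one i) ⟩
    - a * θ (x^ n ∙ one) i + θ (binom^ k c m one) i
      ≡⟨ cong₂ (λ y z → - a * y + z) (θ-monomial n i) (θ-binom^ k c m′ i) ⟩
    - a * (+ n * Xⁿ) + + m * + k * V
      ≡⟨ cong (λ y → - a * (+ n * Xⁿ) + y * V) (trans (sym (pos-* m k)) (cong +_ d≡)) ⟩
    - a * (+ n * Xⁿ) + + d * V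
      ≡⟨ eq₂ a (+ n) (+ d) Xⁿ V c U ⟩
    + n * (- a * Xⁿ + (c * U + V)) + (β * V + - (+ n * c) * U)
      ≡⟨ cong₂ (λ y z → + n * (- a * Xⁿ + y) + z) (sym P^m) (sym P^Q) ⟩
    + n * F i + binom^ k c m′ Q i ∎
    where
    Xⁿ = (x^ n ∙ one) i
    U = binom^ k c m′ one i
    V = binom^ k c m′ (x^ k ∙ one) i
    eq₁ : ∀ l a x p → l * (- a * x + p) ≡ - a * (l * x) + l * p
    eq₁ = solve-∀
    eq₂ : ∀ a n d x v c u → - a * (n * x) + d * v ≡ n * (- a * x + (c * u + v)) + ((d - n) * v + - (n * c) * u)
    eq₂ = solve-∀
    P^m : binom^ k c m one i ≡ c * U + V
    P^m = trans (cong (λ w → w i) (sym (binom^-binom k c m′ one))) (binom^-comb k c m′ c one (x^ k ∙ one) i)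
    P^Q : binom^ k c m′ Q i ≡ β * V + - (+ n * c) * U
    P^Q = trans (binom^-comb k c m′ β (x^ k ∙ one) (- (+ n * c) ⊙ one) i)
      (cong (λ y → β * V + y) (binom^-scale k c m′ (- (+ n * c)) one i))

  -- Evaluation of the resultants and collection of signs and powers

  module _ (c≢0 : c ≢ 0ℤ) (t n₁ k₁ : ℕ) (1≤t : 1 ≤ t) (coprime : Coprime k₁ n₁)
           (n≡ : n ≡ n₁ ℕ.* t) (k≡ : k ≡ k₁ ℕ.* t) where

    private
      M : ℕ
      M = k₁ ℕ.* m

      Br : ℤ
      Br = (+ d) ^ M * c ^ (M ∸ n₁) - a ^ k₁ * (+ n) ^ n₁ * β ^ (M ∸ n₁)

    -- Obtained by cancelling `t` in `n < k m`; it makes the truncated `M ∸ n₁` a true difference,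
    -- as `split-^` requires.
    n₁≤M : n₁ ≤ M
    n₁≤M = ℕ.<⇒≤ (ℕ.*-cancelʳ-< t n₁ M (subst₂ _<_ n≡ (begin
      k ℕ.* m              ≡⟨ cong (ℕ._* m) k≡ ⟩
      k₁ ℕ.* t ℕ.* m       ≡⟨ ℕ.*-assoc k₁ t m ⟩
      k₁ ℕ.* (t ℕ.* m)     ≡⟨ cong (k₁ ℕ.*_) (ℕ.*-comm t m) ⟩
      k₁ ℕ.* (m ℕ.* t)     ≡⟨ ℕ.*-assoc k₁ m t ⟨
      k₁ ℕ.* m ℕ.* t       ∎) n<d))

    1≤k₁ : 1 ≤ k₁
    1≤k₁ = ℕ.n≢0⇒n>0 (λ where refl → ℕ.<⇒≢ 1≤k (sym k≡))

    β≢0 : β ≢ 0ℤ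
    β≢0 e = ℕ.<⇒≢ n<d (sym (ℤ.+-injective (ℤ.i-j≡0⇒i≡j (+ d) (+ n) e)))

    pos≢0 : ∀ {l} → 1 ≤ l → + l ≢ 0ℤ
    pos≢0 1≤l e = ℕ.<⇒≢ 1≤l (sym (ℤ.+-injective e))

    split-^ : ∀ x → x ^ M ≡ x ^ n₁ * x ^ (M ∸ n₁)
    split-^ x = trans (cong (x ^_) (sym (ℕ.m+[n∸m]≡n n₁≤M))) (^-distribˡ-+-* x n₁ (M ∸ n₁))

    ^-n₁t : ∀ x → (x ^ n₁) ^ t ≡ x ^ n
    ^-n₁t x = trans (^-*-assoc x n₁ t) (cong (x ^_) (sym n≡))

    ^-mk₁ : ∀ x → (x ^ m) ^ k₁ ≡ x ^ M
    ^-mk₁ x = trans (^-*-assoc x m k₁) (cong (x ^_) (ℕ.*-comm m k₁))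

    -- Both terms of the binomial formula contain `β ^ n₁ * c ^ n₁`, whose `t`-th power is
    -- `β ^ n * c ^ n`. The signs of `α ^ k₁` and `δ ^ n₁` occur once more in `s`, so only the minus
    -- sign inside `Br` survives.
    Res-Q-binomial : Res k n Q (binomial n (- a * β ^ m) ((+ d * c) ^ m)) ≡ β ^ n * (c ^ n * Br ^ t)
    Res-Q-binomial = begin
      Res k n Q (binomial n α γ)
        ≡⟨ cong₂ (λ k n → Res k n (binomial k β δ) (binomial n α γ)) k≡ n≡ ⟩
      Res (k₁ ℕ.* t) (n₁ ℕ.* t) (binomial (k₁ ℕ.* t) β δ) (binomial (n₁ ℕ.* t) α γ)
        ≡⟨ Res-binomials-coprime t k₁ n₁ 1≤t 1≤k₁ coprime β δ α γ β≢0
             (neg-≢0 (*-≢0 (pos≢0 1≤n) c≢0)) (^-≢0 m (*-≢0 (pos≢0 (ℕ.*-mono-≤ 1≤k (s≤s z≤n))) c≢0)) ⟩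
      (γ ^ k₁ * β ^ n₁ + s * (α ^ k₁ * δ ^ n₁)) ^ t
        ≡⟨ cong (_^ t) simplified ⟩
      (β ^ n₁ * (c ^ n₁ * Br)) ^ t
        ≡⟨ trans (^-distribʳ-* t (β ^ n₁) (c ^ n₁ * Br))
             (cong₂ _*_ (^-n₁t β) (trans (^-distribʳ-* t (c ^ n₁) Br) (cong (_* Br ^ t) (^-n₁t c)))) ⟩
      β ^ n * (c ^ n * Br ^ t) ∎
      where
      α = - a * β ^ m
      γ = (+ d * c) ^ m
      δ = - (+ n * c)
      s = -1ℤ ^ (1 ℕ.+ k₁ ℕ.+ n₁)
      r = M ∸ n₁
      γ^ : γ ^ k₁ ≡ (+ d) ^ M * (c ^ n₁ * c ^ r)
      γ^ = trans (^-mk₁ (+ d * c)) (trans (^-distribʳ-* M (+ d) c) (cong ((+ d) ^ M *_) (split-^ c)))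
      α^ : α ^ k₁ ≡ -1ℤ ^ k₁ * a ^ k₁ * (β ^ n₁ * β ^ r)
      α^ = trans (^-distribʳ-* k₁ (- a) (β ^ m)) (cong₂ _*_ (neg-^ k₁ a) (trans (^-mk₁ β) (split-^ β)))
      δ^ : δ ^ n₁ ≡ -1ℤ ^ n₁ * ((+ n) ^ n₁ * c ^ n₁)
      δ^ = trans (neg-^ n₁ (+ n * c)) (cong (-1ℤ ^ n₁ *_) (^-distribʳ-* n₁ (+ n) c))
      eq : ∀ D c₁ c₂ b₁ b₂ u v A N →
        D * (c₁ * c₂) * b₁ + -1ℤ * (u * v) * (u * A * (b₁ * b₂) * (v * (N * c₁))) ≡
        b₁ * (c₁ * (D * c₂ - u * u * (v * v) * (A * N * b₂)))
      eq = solve-∀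
      simplified : γ ^ k₁ * β ^ n₁ + s * (α ^ k₁ * δ ^ n₁) ≡ β ^ n₁ * (c ^ n₁ * Br)
      simplified = begin
        γ ^ k₁ * β ^ n₁ + s * (α ^ k₁ * δ ^ n₁)
          ≡⟨ cong₂ (λ y z → y * β ^ n₁ + s * z) γ^ (cong₂ _*_ α^ δ^) ⟩
        (+ d) ^ M * (c ^ n₁ * c ^ r) * β ^ n₁ +
          s * (-1ℤ ^ k₁ * a ^ k₁ * (β ^ n₁ * β ^ r) * (-1ℤ ^ n₁ * ((+ n) ^ n₁ * c ^ n₁)))
          ≡⟨ cong (λ y → (+ d) ^ M * (c ^ n₁ * c ^ r) * β ^ n₁ +
                -1ℤ * y * (-1ℤ ^ k₁ * a ^ k₁ * (β ^ n₁ * β ^ r) * (-1ℤ ^ n₁ * ((+ n) ^ n₁ * c ^ n₁))))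
               (^-distribˡ-+-* -1ℤ k₁ n₁) ⟩
        (+ d) ^ M * (c ^ n₁ * c ^ r) * β ^ n₁ +
          -1ℤ * (-1ℤ ^ k₁ * -1ℤ ^ n₁) * (-1ℤ ^ k₁ * a ^ k₁ * (β ^ n₁ * β ^ r) * (-1ℤ ^ n₁ * ((+ n) ^ n₁ * c ^ n₁)))
          ≡⟨ eq ((+ d) ^ M) (c ^ n₁) (c ^ r) (β ^ n₁) (β ^ r) (-1ℤ ^ k₁) (-1ℤ ^ n₁) (a ^ k₁) ((+ n) ^ n₁) ⟩
        β ^ n₁ * (c ^ n₁ * ((+ d) ^ M * c ^ r - -1ℤ ^ k₁ * -1ℤ ^ k₁ * (-1ℤ ^ n₁ * -1ℤ ^ n₁) * (a ^ k₁ * (+ n) ^ n₁ * β ^ r)))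
          ≡⟨ cong (λ y → β ^ n₁ * (c ^ n₁ * ((+ d) ^ M * c ^ r - y)))
               (trans (cong (_* (a ^ k₁ * (+ n) ^ n₁ * β ^ r)) (cong₂ _*_ (sign² k₁) (sign² n₁))) (*-identityˡ _)) ⟩
        β ^ n₁ * (c ^ n₁ * Br) ∎

    -- The powers of `β` balance: scaling the `k` rows by `β ^ m` gives `β ^ d`, while the degree
    -- drop and the binomials give `β ^ (d ∸ n)` and `β ^ n`. They cancel since `n < d`.
    Res-F-Q : Res d k F Q ≡ -1ℤ ^ (k ℕ.* d) * (c ^ n * Br ^ t)
    Res-F-Q = trans (Res-swap d k F Q) (cong (-1ℤ ^ (k ℕ.* d) *_) (cancelˡ (^-≢0 d β≢0) (begin
      β ^ d * Res k d Q F
        ≡⟨ cong (λ l → β ^ l * Res k d Q F) d≡ ⟨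
      β ^ (m ℕ.* k) * Res k d Q F
        ≡⟨ cong (_* Res k d Q F) (^-*-assoc β m k) ⟨
      (β ^ m) ^ k * Res k d Q F
        ≡⟨ Res-F β (- (+ n * c)) ⟩
      β ^ (d ∸ n) * Res k n Q (binomial n (- a * β ^ m) ((β * c - - (+ n * c)) ^ m))
        ≡⟨ cong (λ κ → β ^ (d ∸ n) * Res k n Q (binomial n (- a * β ^ m) (κ ^ m))) (eq (+ d) (+ n) c) ⟩
      β ^ (d ∸ n) * Res k n Q (binomial n (- a * β ^ m) ((+ d * c) ^ m))
        ≡⟨ cong (β ^ (d ∸ n) *_) Res-Q-binomial ⟩
      β ^ (d ∸ n) * (β ^ n * (c ^ n * Br ^ t))
        ≡⟨ *-assoc (β ^ (d ∸ n)) (β ^ n) (c ^ n * Br ^ t) ⟨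
      β ^ (d ∸ n) * β ^ n * (c ^ n * Br ^ t)
        ≡⟨ cong (_* (c ^ n * Br ^ t)) (^-distribˡ-+-* β (d ∸ n) n) ⟨
      β ^ (d ∸ n ℕ.+ n) * (c ^ n * Br ^ t)
        ≡⟨ cong (λ l → β ^ l * (c ^ n * Br ^ t)) (ℕ.m∸n+n≡m (ℕ.<⇒≤ n<d)) ⟩
      β ^ d * (c ^ n * Br ^ t) ∎)))
      where
      eq : ∀ d n c → (d - n) * c - - (n * c) ≡ d * c
      eq = solve-∀

    Res-F-derivative : ∀ d′ G → suc d′ ≡ d → Below d G → x^ 1 ∙ G ≗ θ F →
      -1ℤ ^ d * c ^ m * Res d d′ F G ≡ Res d k F (binom k c one) ^ m′ * Res d k F Q
    Res-F-derivative d′ G d′≡ bG e = begin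
      -1ℤ ^ d * c ^ m * Res d d′ F G
        ≡⟨ cong (_* Res d d′ F G) (trans (cong (-1ℤ ^ d *_) (sym F-bottom)) (sym (Res-x d F below-F))) ⟩
      Res d 1 F (x^ 1 ∙ one) * Res d d′ F G
        ≡⟨ cong (_* Res d d′ F G) (Res-cong d 1 {F} (λ _ → refl) (x≗binom one)) ⟩
      Res d 1 F (binom 1 0ℤ one) * Res d d′ F G
        ≡⟨ Res-binom 1 0ℤ ℕ.≤-refl d d′ F G below-F (subst (λ l → Below l G) (sym d′≡) bG) ⟨
      Res d (d′ ℕ.+ 1) F (binom 1 0ℤ G)
        ≡⟨ Res-cong d (d′ ℕ.+ 1) {F} (λ _ → refl) (λ i → trans (sym (x≗binom G i)) (e i)) ⟩
      Res d (d′ ℕ.+ 1) F (θ F)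
        ≡⟨ cong (λ l → Res d l F (θ F)) (trans (ℕ.+-comm d′ 1) d′≡) ⟩
      Res d d F (θ F)
        ≡⟨ trans (cong (_* Res d d F (θ F)) (^-zeroˡ d)) (*-identityˡ _) ⟨
      1ℤ ^ d * Res d d F (θ F)
        ≡⟨ Res-reduce d d F 1ℤ (θ F) (binom^ k c m′ Q) multiple ⟩
      Res d d F (binom^ k c m′ Q)
        ≡⟨ cong (λ l → Res d l F (binom^ k c m′ Q)) (trans (ℕ.+-comm (m′ ℕ.* k) k) d≡) ⟨
      Res d (m′ ℕ.* k ℕ.+ k) F (binom^ k c m′ Q)
        ≡⟨ Res-binom^ k c 1≤k d F below-F m′ Q (below-binomial k β (- (+ n * c))) ⟩
      Res d k F (binom k c one) ^ m′ * Res d k F Q ∎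
      where
      eq : ∀ x y → x + 0ℤ ≡ 1ℤ * (x + y) + -1ℤ * y
      eq = solve-∀
      difference : (+ n ⊙ F ⊕ 𝟘) ≗ (1ℤ ⊙ θ F ⊕ -1ℤ ⊙ binom^ k c m′ Q)
      difference i = trans (eq (+ n * F i) (binom^ k c m′ Q i))
        (cong (λ y → 1ℤ * y + -1ℤ * binom^ k c m′ Q i) (sym (θ-F i)))
      multiple : ∀ i → i < d → Multiple d F (x^ i ∙ (1ℤ ⊙ θ F ⊕ -1ℤ ⊙ binom^ k c m′ Q))
      multiple i i<d = cong-≗ (x^-cong i difference)
        (span-map {P = _≡ F} i (λ where refl → i , i<d , refl) (comb (+ n) (gen refl) null))

    -- Both exponents have the parity of `d`, as `d m = k m m` and `k d m = d d`. This converts the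
    -- signs of exchanging `F` with `P`, `m′` times, and with `Q`, once, into powers of the sign of
    -- the resultant of `F` and `x`.
    sign-d : (-1ℤ ^ d) ^ m ≡ (-1ℤ ^ (k ℕ.* d)) ^ m
    sign-d = begin
      (-1ℤ ^ d) ^ m            ≡⟨ ^-*-assoc -1ℤ d m ⟩
      -1ℤ ^ (k ℕ.* m ℕ.* m)    ≡⟨ cong (-1ℤ ^_) (trans (ℕ.*-assoc k m m) (ℕ.*-comm k (m ℕ.* m))) ⟩
      -1ℤ ^ (m ℕ.* m ℕ.* k)    ≡⟨ ^-*-assoc -1ℤ (m ℕ.* m) k ⟨
      (-1ℤ ^ (m ℕ.* m)) ^ k    ≡⟨ cong (_^ k) (sign-square m) ⟩
      (-1ℤ ^ m) ^ k            ≡⟨ ^-*-assoc -1ℤ m k ⟩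
      -1ℤ ^ (m ℕ.* k)          ≡⟨ cong (-1ℤ ^_) d≡ ⟩
      -1ℤ ^ d                  ≡⟨ sign-square d ⟨
      -1ℤ ^ (d ℕ.* d)          ≡⟨ cong (-1ℤ ^_) (trans (ℕ.*-assoc k m d) (trans (cong (k ℕ.*_) (ℕ.*-comm m d)) (sym (ℕ.*-assoc k d m)))) ⟩
      -1ℤ ^ (k ℕ.* d ℕ.* m)    ≡⟨ ^-*-assoc -1ℤ (k ℕ.* d) m ⟨
      (-1ℤ ^ (k ℕ.* d)) ^ m    ∎

    -- By `parity`, `k n` has the parity of `(1 + k₁ + n₁) t = t + k + n`, and the two copies of `k`
    -- cancel.
    sign-kn : -1ℤ ^ k * -1ℤ ^ (k ℕ.* n) ≡ -1ℤ ^ (n ℕ.+ t)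
    sign-kn = begin
      -1ℤ ^ k * -1ℤ ^ (k ℕ.* n)
        ≡⟨ cong (λ l → -1ℤ ^ k * -1ℤ ^ l) (cong₂ ℕ._*_ k≡ n≡) ⟩
      -1ℤ ^ k * -1ℤ ^ (k₁ ℕ.* t ℕ.* (n₁ ℕ.* t))
        ≡⟨ cong (-1ℤ ^ k *_) (parity t (coprime⇒euclid coprime)) ⟨
      -1ℤ ^ k * (-1ℤ ^ (1 ℕ.+ k₁ ℕ.+ n₁)) ^ t
        ≡⟨ cong (-1ℤ ^ k *_) (^-*-assoc -1ℤ (1 ℕ.+ k₁ ℕ.+ n₁) t) ⟩
      -1ℤ ^ k * -1ℤ ^ ((1 ℕ.+ k₁ ℕ.+ n₁) ℕ.* t)
        ≡⟨ cong (λ l → -1ℤ ^ k * -1ℤ ^ l) exponent ⟩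
      -1ℤ ^ k * -1ℤ ^ (k ℕ.+ (n ℕ.+ t))
        ≡⟨ cong (-1ℤ ^ k *_) (^-distribˡ-+-* -1ℤ k (n ℕ.+ t)) ⟩
      -1ℤ ^ k * (-1ℤ ^ k * -1ℤ ^ (n ℕ.+ t))
        ≡⟨ *-assoc (-1ℤ ^ k) (-1ℤ ^ k) (-1ℤ ^ (n ℕ.+ t)) ⟨
      -1ℤ ^ k * -1ℤ ^ k * -1ℤ ^ (n ℕ.+ t)
        ≡⟨ trans (cong (_* -1ℤ ^ (n ℕ.+ t)) (sign² k)) (*-identityˡ _) ⟩
      -1ℤ ^ (n ℕ.+ t) ∎
      where
      exponent : (1 ℕ.+ k₁ ℕ.+ n₁) ℕ.* t ≡ k ℕ.+ (n ℕ.+ t)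
      exponent = begin
        t ℕ.+ (k₁ ℕ.+ n₁) ℕ.* t          ≡⟨ cong (t ℕ.+_) (ℕ.*-distribʳ-+ t k₁ n₁) ⟩
        t ℕ.+ (k₁ ℕ.* t ℕ.+ n₁ ℕ.* t)    ≡⟨ cong₂ (λ x y → t ℕ.+ (x ℕ.+ y)) k≡ n≡ ⟨
        t ℕ.+ (k ℕ.+ n)                  ≡⟨ ℕ.+-comm t (k ℕ.+ n) ⟩
        k ℕ.+ n ℕ.+ t                    ≡⟨ ℕ.+-assoc k n t ⟩
        k ℕ.+ (n ℕ.+ t)                  ∎

    factor-value : (- a) ^ k * (-1ℤ ^ k * c) ^ n ≡ -1ℤ ^ (n ℕ.+ t) * (a ^ k * c ^ n)
    factor-value = begin
      (- a) ^ k * (-1ℤ ^ k * c) ^ n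
        ≡⟨ cong₂ _*_ (neg-^ k a) (^-distribʳ-* n (-1ℤ ^ k) c) ⟩
      -1ℤ ^ k * a ^ k * ((-1ℤ ^ k) ^ n * c ^ n)
        ≡⟨ cong (λ y → -1ℤ ^ k * a ^ k * (y * c ^ n)) (^-*-assoc -1ℤ k n) ⟩
      -1ℤ ^ k * a ^ k * (-1ℤ ^ (k ℕ.* n) * c ^ n)
        ≡⟨ eq (-1ℤ ^ k) (a ^ k) (-1ℤ ^ (k ℕ.* n)) (c ^ n) ⟩
      -1ℤ ^ k * -1ℤ ^ (k ℕ.* n) * (a ^ k * c ^ n)
        ≡⟨ cong (_* (a ^ k * c ^ n)) sign-kn ⟩
      -1ℤ ^ (n ℕ.+ t) * (a ^ k * c ^ n) ∎
      where
      eq : ∀ u a v c → u * a * (v * c) ≡ u * v * (a * c)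
      eq = solve-∀

    -- Of the power `c ^ (n m)` gathered from `P` and `Q`, the part `c ^ m` is cancelled by the
    -- resultant of `F` and `x`; this is where `n - 1` comes from.
    c-power : c ^ m * c ^ (m ℕ.* (n ∸ 1)) ≡ (c ^ n) ^ m
    c-power = begin
      c ^ m * c ^ (m ℕ.* (n ∸ 1))      ≡⟨ ^-distribˡ-+-* c m (m ℕ.* (n ∸ 1)) ⟨
      c ^ (m ℕ.+ m ℕ.* (n ∸ 1))        ≡⟨ cong (c ^_) (ℕ.*-suc m (n ∸ 1)) ⟨
      c ^ (m ℕ.* suc (n ∸ 1))          ≡⟨ cong (λ l → c ^ (m ℕ.* l)) (ℕ.m+[n∸m]≡n 1≤n) ⟩
      c ^ (m ℕ.* n)                    ≡⟨ cong (c ^_) (ℕ.*-comm m n) ⟩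
      c ^ (n ℕ.* m)                    ≡⟨ ^-*-assoc c n m ⟨
      (c ^ n) ^ m                      ∎

    Res-F-value : ∀ d′ G → suc d′ ≡ d → Below d G → x^ 1 ∙ G ≗ θ F →
      Res d d′ F G ≡ -1ℤ ^ ((d ℕ.+ n ℕ.+ t) ℕ.* m′) * (a ^ (k ℕ.* m′) * (c ^ (m ℕ.* (n ∸ 1)) * Br ^ t))
    Res-F-value d′ G d′≡ bG e = cancelˡ (*-≢0 (^-≢0 d (λ ())) (^-≢0 m c≢0)) (begin
      ε * c ^ m * Res d d′ F G
        ≡⟨ Res-F-derivative d′ G d′≡ bG e ⟩
      Res d k F (binom k c one) ^ m′ * Res d k F Q
        ≡⟨ cong₂ (λ y z → y ^ m′ * z) (trans Res-F-factor (cong (s *_) factor-value)) Res-F-Q ⟩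
      (s * (u * (a ^ k * c ^ n))) ^ m′ * (s * (c ^ n * Br ^ t))
        ≡⟨ cong (_* (s * (c ^ n * Br ^ t))) (begin
             (s * (u * (a ^ k * c ^ n))) ^ m′
               ≡⟨ ^-distribʳ-* m′ s (u * (a ^ k * c ^ n)) ⟩
             s ^ m′ * (u * (a ^ k * c ^ n)) ^ m′
               ≡⟨ cong (s ^ m′ *_) (^-distribʳ-* m′ u (a ^ k * c ^ n)) ⟩
             s ^ m′ * (u ^ m′ * (a ^ k * c ^ n) ^ m′)
               ≡⟨ cong (λ y → s ^ m′ * (u ^ m′ * y)) (^-distribʳ-* m′ (a ^ k) (c ^ n)) ⟩
             s ^ m′ * (u ^ m′ * ((a ^ k) ^ m′ * (c ^ n) ^ m′)) ∎) ⟩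
      s ^ m′ * (u ^ m′ * ((a ^ k) ^ m′ * (c ^ n) ^ m′)) * (s * (c ^ n * Br ^ t))
        ≡⟨ eq₁ s (s ^ m′) (u ^ m′) ((a ^ k) ^ m′) (c ^ n) ((c ^ n) ^ m′) (Br ^ t) ⟩
      s ^ m * (u ^ m′ * ((a ^ k) ^ m′ * ((c ^ n) ^ m * Br ^ t)))
        -- One `ε` and the factor `c ^ m` are set aside for the cancellation; the remaining `ε ^ m′`
        -- joins `u ^ m′` to form the exponent `(d + n + t) m′`.
        ≡⟨ cong₂ (λ y z → y * (u ^ m′ * ((a ^ k) ^ m′ * (z * Br ^ t)))) (sym sign-d) (sym c-power) ⟩
      ε * ε ^ m′ * (u ^ m′ * ((a ^ k) ^ m′ * (c ^ m * cᵉ * Br ^ t)))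
        ≡⟨ eq₂ ε (ε ^ m′) (u ^ m′) ((a ^ k) ^ m′) (c ^ m) cᵉ (Br ^ t) ⟩
      ε * c ^ m * (ε ^ m′ * u ^ m′ * ((a ^ k) ^ m′ * (cᵉ * Br ^ t)))
        ≡⟨ cong₂ (λ y z → ε * c ^ m * (y * (z * (cᵉ * Br ^ t)))) signs (^-*-assoc a k m′) ⟩
      ε * c ^ m * (-1ℤ ^ ((d ℕ.+ n ℕ.+ t) ℕ.* m′) * (a ^ (k ℕ.* m′) * (cᵉ * Br ^ t))) ∎)
      where
      ε = -1ℤ ^ d
      s = -1ℤ ^ (k ℕ.* d)
      u = -1ℤ ^ (n ℕ.+ t)
      cᵉ = c ^ (m ℕ.* (n ∸ 1))
      eq₁ : ∀ s s′ u a c c′ b → s′ * (u * (a * c′)) * (s * (c * b)) ≡ s * s′ * (u * (a * (c * c′ * b)))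
      eq₁ = solve-∀
      eq₂ : ∀ ε ε′ u a c cᵉ b → ε * ε′ * (u * (a * (c * cᵉ * b))) ≡ ε * c * (ε′ * u * (a * (cᵉ * b)))
      eq₂ = solve-∀
      signs : ε ^ m′ * u ^ m′ ≡ -1ℤ ^ ((d ℕ.+ n ℕ.+ t) ℕ.* m′)
      signs = begin
        ε ^ m′ * u ^ m′                       ≡⟨ ^-distribʳ-* m′ ε u ⟨
        (ε * u) ^ m′                          ≡⟨ cong (_^ m′) (^-distribˡ-+-* -1ℤ d (n ℕ.+ t)) ⟨
        (-1ℤ ^ (d ℕ.+ (n ℕ.+ t))) ^ m′        ≡⟨ cong (λ l → (-1ℤ ^ l) ^ m′) (ℕ.+-assoc d n t) ⟨
        (-1ℤ ^ (d ℕ.+ n ℕ.+ t)) ^ m′          ≡⟨ ^-*-assoc -1ℤ (d ℕ.+ n ℕ.+ t) m′ ⟩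
        -1ℤ ^ ((d ℕ.+ n ℕ.+ t) ℕ.* m′)        ∎

    discriminant-f : discriminant (f a c k m n) ≡
      -1ℤ ^ (d C 2 ℕ.+ (d ℕ.+ n ℕ.+ t) ℕ.* m′) * a ^ (k ℕ.* m′) * c ^ (m ℕ.* (n ∸ 1)) * Br ^ t
    discriminant-f = begin
      -1ℤ ^ (degree p C 2) * resultant p p′
        ≡⟨ cong₂ (λ x y → -1ℤ ^ (x C 2) * det (sylvester x y p p′)) degree-p degree-p′ ⟩
      -1ℤ ^ (d C 2) * det (sylvester d d′ p p′)
        ≡⟨ cong (-1ℤ ^ (d C 2) *_) (begin
             det (sylvester d d′ p p′)               ≡⟨ det-sylvester d d′ p p′ ⟩
             Res d d′ (coeff p) (coeff p′)           ≡⟨ Res-cong d d′ {q = coeff p′} p≗F (λ _ → refl) ⟩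
             Res d d′ F (coeff p′)                   ≡⟨ Res-F-value d′ (coeff p′) d′≡ below-p′ xp′≗θF ⟩
             -1ℤ ^ ((d ℕ.+ n ℕ.+ t) ℕ.* m′) * (aᵉ * (cᵉ * Br ^ t))  ∎) ⟩
      -1ℤ ^ (d C 2) * (-1ℤ ^ ((d ℕ.+ n ℕ.+ t) ℕ.* m′) * (aᵉ * (cᵉ * Br ^ t)))
        ≡⟨ eq (-1ℤ ^ (d C 2)) (-1ℤ ^ ((d ℕ.+ n ℕ.+ t) ℕ.* m′)) aᵉ cᵉ (Br ^ t) ⟩
      -1ℤ ^ (d C 2) * -1ℤ ^ ((d ℕ.+ n ℕ.+ t) ℕ.* m′) * aᵉ * cᵉ * Br ^ t
        ≡⟨ cong (λ y → y * aᵉ * cᵉ * Br ^ t) (^-distribˡ-+-* -1ℤ (d C 2) ((d ℕ.+ n ℕ.+ t) ℕ.* m′)) ⟨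
      -1ℤ ^ (d C 2 ℕ.+ (d ℕ.+ n ℕ.+ t) ℕ.* m′) * aᵉ * cᵉ * Br ^ t ∎
      where
      p = f a c k m n
      p′ = derivative p
      d′ = d ∸ 1
      aᵉ = a ^ (k ℕ.* m′)
      cᵉ = c ^ (m ℕ.* (n ∸ 1))
      eq : ∀ x y a c b → x * (y * (a * (c * b))) ≡ x * y * a * c * b
      eq = solve-∀
      1≤d : 1 ≤ d
      1≤d = ℕ.≤-trans (s≤s z≤n) n<d
      d′≡ : suc d′ ≡ d
      d′≡ = ℕ.m+[n∸m]≡n 1≤d
      p≗F : coeff p ≗ F
      p≗F = coeff-f a c k m n
      xp′≗θF : x^ 1 ∙ coeff p′ ≗ θ F
      xp′≗θF i = trans (coeff-derivative p i) (cong (+ i *_) (p≗F i))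
      below-p′ : Below d (coeff p′)
      below-p′ i d≤i = trans (xp′≗θF (suc i)) (trans (cong (+ suc i *_) (below-F (suc i) (s≤s d≤i))) (*-zeroʳ (+ suc i)))
      degree-p : degree p ≡ d
      degree-p = degree-top p d (λ i d<i → trans (p≗F i) (below-F i d<i))
        (λ e → contradiction (trans (sym F-top) (trans (sym (p≗F d)) e)) (λ ()))
      -- `resultant` uses the actual degrees, so the derivative must have degree exactly `d′`; its
      -- leading coefficient is `d` because `F` is monic.
      top-p′ : coeff p′ d′ ≡ + d
      top-p′ = begin
        coeff p′ d′              ≡⟨ xp′≗θF (suc d′) ⟩
        θ F (suc d′)             ≡⟨ cong (θ F) d′≡ ⟩
        + d * F d                ≡⟨ trans (cong (+ d *_) F-top) (*-identityʳ (+ d)) ⟩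
        + d                      ∎
      degree-p′ : degree p′ ≡ d′
      degree-p′ = degree-top p′ d′ (subst (λ l → Below l (coeff p′)) (sym d′≡) below-p′)
        (λ e → pos≢0 1≤d (trans (sym top-p′) e))

coprime-quotients : ∀ {t n k n₁ k₁} → 1 ≤ t → t ≡ gcd n k → n ≡ n₁ ℕ.* t → k ≡ k₁ ℕ.* t → Coprime k₁ n₁
coprime-quotients {t@(suc _)} _ t≡ refl refl {e} (e∣k₁ , e∣n₁) =
  ∣1⇒≡1 (*-cancelʳ-∣ t (subst (e ℕ.* t ∣_) (trans (sym t≡) (sym (ℕ.*-identityˡ t)))
    (gcd-greatest (*-monoˡ-∣ t e∣n₁) (*-monoˡ-∣ t e∣k₁))))

mainTheorem1 : (a c : ℤ) (k m n : ℕ) →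
    c ≢ 0ℤ → n < k ℕ.* m → 1 ≤ n →
    IrreducibleOverℚ (f a c k m n) →
    (t n₁ k₁ : ℕ) → t ≡ gcd n k → n ≡ n₁ ℕ.* t → k ≡ k₁ ℕ.* t →
    discriminant (f a c k m n) ≡
    -1ℤ ^ ((k ℕ.* m) C 2 ℕ.+ (k ℕ.* m ℕ.+ n ℕ.+ t) ℕ.* (m ∸ 1))
    * a ^ (k ℕ.* (m ∸ 1))
    * c ^ (m ℕ.* (n ∸ 1))
    * ( (+ (k ℕ.* m)) ^ (k₁ ℕ.* m) * c ^ (k₁ ℕ.* m ∸ n₁)
    - a ^ k₁ * (+ n) ^ n₁ * (+ (k ℕ.* m) - + n) ^ (k₁ ℕ.* m ∸ n₁) ) ^ t
-- The bound on `n` excludes `m = 0`. For `k = 0` and `m` a successor the product computes to 0, so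
-- that case is visibly empty and has no clause.
mainTheorem1 a c k zero n c≢0 n<d = contradiction (subst (n <_) (ℕ.*-zeroʳ k) n<d) λ ()
mainTheorem1 a c k@(suc _) (suc m′) n c≢0 n<d 1≤n _ t n₁ k₁ t≡ n≡ k≡ =
  discriminant-f a c k m′ n (s≤s z≤n) 1≤n n<d c≢0 t n₁ k₁ 1≤t (coprime-quotients 1≤t t≡ n≡ k≡) n≡ k≡
  where
  1≤t : 1 ≤ t
  1≤t = ℕ.n≢0⇒n>0 (λ where refl → contradiction (trans k≡ (ℕ.*-zeroʳ k₁)) (λ ()))
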